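{- Let $\mathcal{X}_n$ denote the set of $n$-variable Boolean functions $f:\{ -1,1\}^n\to\{ -1,1\}$ that are bent, or satisfy $\mathrm{SAC}(k)$ for some $k\ge0$, or satisfy $\mathrm{PC}(k)$ for some $k\ge1$. Then: (1) for every $n\ge 4$, no $n$-variable monotone Boolean function belongs to $\mathcal{X}_n$; (2) for every $n\ge 16$, no $n$-variable linear threshold function belongs to $\mathcal{X}_n$; (3) for every positive integer $d$ there exists a positive integer $\mathfrak n_0$ (depending on $d$) such that for every $n\ge\mathfrak n_0$, no $n$-variable Boolean function in $\mathrm{AC}^0[d]$ belongs to $\mathcal{X}_n$.
   Context: For $f:\{ -1,1\}^n\to\{ -1,1\}$ and $S\subseteq[n]$, $\widehat f(S)=2^{ -n}\sum_{\mathbf x\in\{ -1,1\}^n} f(\mathbf x)\prod_{i\in S}x_i$. $\mathbf x^{\oplus i}$ ($\mathbf x^{\oplus S}$) denotes $\mathbf x$ with coordinate $i$ (all coordinates in $S$) negated. $\mathrm{Inf}_i(f)=\Pr_{\mathbf x}[f(\mathbf x)\ne f(\mathbf x^{\oplus i})]$ and $\mathrm{Inf}_S(f)=\Pr_{\mathbf x}[f(\mathbf x)\ne f(\mathbf x^{\oplus S})]$ for uniform $\mathbf x$. For even $n$, $f$ is bent if $\widehat f(S)=\pm2^{ -n/2}$ for all $S\subseteq[n]$. $f$ satisfies SAC if $\mathrm{Inf}_i(f)=1/2$ for all $i$; for $0\le k\le n-2$, $f$ satisfies $\mathrm{SAC}(k)$ if fixing any $k$ variables to arbitrary values in $\{ -1,1\}$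 yields a function satisfying SAC. For $1\le k\le n$, $f$ satisfies $\mathrm{PC}(k)$ if $\mathrm{Inf}_S(f)=1/2$ for all $S$ with $1\le|S|\le k$. $f$ is monotone if $\mathbf a\le\mathbf b$ coordinatewise implies $f(\mathbf a)\le f(\mathbf b)$. $f$ is a linear threshold function if there are reals $w_0,\dots,w_n$ with $f(\mathbf x)=\mathrm{sign}(w_0+w_1x_1+\cdots+w_nx_n)$ for all $\mathbf x$, where $\mathrm{sign}(z)=1$ if $z>0$ and $-1$ if $z\le0$. A depth-$d$ circuit on $n$ variables is a leveled circuit of unbounded fan-in AND and OR gates with inputs $x_1,\dots,x_n,\overline{x}_1,\dots,\overline{x}_n$, with $d$ levels, gates at level $i$ taking inputs only from level $i-1$, all gates on a level of the same type and types alternating between levels; its size is its number of gates. $\mathrm{AC}^0[d]$ is the set of Boolean functions computable by depth-$d$ circuits whose size is bounded by a (fixed) polynomial in $n$.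
   Formalization: In part (2) the weights w_0,…,w_n of a linear threshold function are taken rational rather than real; on the finite cube this gives the same class of functions by perturbing the weights. -}

module Defs where

open import Data.Bool using (Bool; true; false; not; _xor_; _∧_; _∨_; if_then_else_)
  renaming (_≤_ to _≤ᵇ_)
open import Data.Nat using (ℕ; zero; suc; _+_; _*_; _^_; _≤_)
open import Data.Fin using (Fin; _≟_)
open import Data.List using (List; []; _∷_; [_]; map; foldr; length; filterᵇ; allFin; concatMap)
open import Data.Bool.ListAction using (and; or)
open import Data.Vec using (Vec; lookup)
open import Data.Vec.Functional using (Vector) renaming (_∷_ to _∷ᶠ_)
open import Data.Integer as ℤ using (ℤ; +_; -_)
open import Data.Rational as ℚ using (ℚ; 0ℚ; 1ℚ)
open import Data.Product using (Σ; _×_; ∃)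
open import Data.Sum using (_⊎_)
open import Relation.Binary.PropositionalEquality using (_≡_)
open import Relation.Nullary.Decidable using (does)

-- Encoding: an element of {-1,1} is a Bool, with true ↦ 1 and false ↦ -1.
-- Inputs x ∈ {-1,1}^n are functions Fin n → Bool.
Input : ℕ → Set
Input n = Fin n → Bool

BoolFun : ℕ → Set
BoolFun n = Input n → Bool

toℤ : Bool → ℤ
toℤ true  = + 1
toℤ false = - (+ 1)

toℚ : Bool → ℚ
toℚ true  = 1ℚ
toℚ false = ℚ.- 1ℚ

allInputs : (n : ℕ) → List (Input n)
allInputs zero    = [ (λ ()) ]
allInputs (suc n) = concatMap (λ x → (true ∷ᶠ x) ∷ (false ∷ᶠ x) ∷ []) (allInputs n)

count : {n : ℕ} → (Input n → Bool) → ℕ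
count {n} p = length (filterᵇ p (allInputs n))

SubsetN : ℕ → Set
SubsetN n = Fin n → Bool

card : {n : ℕ} → SubsetN n → ℕ
card {n} S = length (filterᵇ S (allFin n))

flipSet : {n : ℕ} → SubsetN n → Input n → Input n
flipSet S x j = if S j then not (x j) else x j

flipAt : {n : ℕ} → Fin n → Input n → Input n
flipAt i x j = if does (i ≟ j) then not (x j) else x j

-- 2^n · \hat f(S) = Σ_x f(x) Π_{i∈S} x_i   (an integer)
chi : {n : ℕ} → SubsetN n → Input n → ℤ
chi {n} S x = foldr ℤ._*_ (+ 1) (map (λ i → if S i then toℤ (x i) else + 1) (allFin n))

fourier2n : {n : ℕ} → BoolFun n → SubsetN n → ℤ
fourier2n {n} f S = foldr ℤ._+_ (+ 0) (map (λ x → toℤ (f x) ℤ.* chi S x) (allInputs n))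

InfHalf : {n : ℕ} → BoolFun n → Fin n → Set
InfHalf {n} f i = 2 * count (λ x → f x xor f (flipAt i x)) ≡ 2 ^ n

InfSetHalf : {n : ℕ} → BoolFun n → SubsetN n → Set
InfSetHalf {n} f S = 2 * count (λ x → f x xor f (flipSet S x)) ≡ 2 ^ n

-- bent: n even (n = 2m) and \hat f(S) = ± 2^{-m}, i.e. 2^n \hat f(S) = ± 2^m
Bent : (n : ℕ) → BoolFun n → Set
Bent n f = Σ ℕ λ m → (n ≡ 2 * m) ×
  ((S : SubsetN n) → (fourier2n f S ≡ + (2 ^ m)) ⊎ (fourier2n f S ≡ - (+ (2 ^ m))))

SAC : (n : ℕ) → BoolFun n → Set
SAC n f = (i : Fin n) → InfHalf f i

-- fixing the variables in T to the values given by a; the restricted function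
-- is represented on all n coordinates, the coordinates in T being dummy
restrict : {n : ℕ} → BoolFun n → SubsetN n → Input n → BoolFun n
restrict f T a x = f (λ j → if T j then a j else x j)

SACk : (n k : ℕ) → BoolFun n → Set
SACk n k f = (T : SubsetN n) → card T ≡ k → (a : Input n) →
  (i : Fin n) → T i ≡ false → InfHalf (restrict f T a) i

PCk : (n k : ℕ) → BoolFun n → Set
PCk n k f = (S : SubsetN n) → 1 ≤ card S → card S ≤ k → InfSetHalf f S

InX : (n : ℕ) → BoolFun n → Set
InX n f = Bent n f
  ⊎ (Σ ℕ λ k → (k + 2 ≤ n) × SACk n k f)
  ⊎ (Σ ℕ λ k → (1 ≤ k) × (k ≤ n) × PCk n k f)

Monotone : (n : ℕ) → BoolFun n → Set
Monotone n f = (a b : Input n) → ((i : Fin n) → a i ≤ᵇ b i) → f a ≤ᵇ f b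

sumFin : {n : ℕ} → (Fin n → ℚ) → ℚ
sumFin {n} g = foldr ℚ._+_ 0ℚ (map g (allFin n))

LTF : (n : ℕ) → BoolFun n → Set
LTF n f = Σ ℚ λ w₀ → Σ (Fin n → ℚ) λ w → (x : Input n) →
  let s = w₀ ℚ.+ sumFin (λ i → w i ℚ.* toℚ (x i)) in
  (f x ≡ true → 0ℚ ℚ.< s) × (0ℚ ℚ.< s → f x ≡ true)

-- Leveled circuits. Levels n d w : d levels, top level has w gates.
-- Level-1 gates read literals (i , pol): pol = true means x_i, false means ¬x_i.
-- Gates at level d+1 read (by index) gates of level d.
data Levels (n : ℕ) : ℕ → ℕ → Set where
  first : (w : ℕ) → Vec (List (Fin n × Bool)) w → Levels n 1 w
  next  : {d w : ℕ} → Levels n d w → (w' : ℕ) → Vec (List (Fin w)) w' → Levels n (suc d) w'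

gate : Bool → List Bool → Bool
gate true  = and
gate false = or

literal : {n : ℕ} → Input n → Fin n × Bool → Bool
literal x (i Data.Product., true)  = x i
literal x (i Data.Product., false) = not (x i)

evalL : {n d w : ℕ} → Levels n d w → Bool → Input n → Fin w → Bool
evalL (first w gs)  t x j = gate t (map (literal x) (lookup gs j))
evalL (next L w' gs) t x j = gate t (map (evalL L (not t) x) (lookup gs j))

size : {n d w : ℕ} → Levels n d w → ℕ
size (first w _)    = w
size (next L w' _)  = size L + w'

ComputedByCircuit : (n d s : ℕ) → BoolFun n → Set
ComputedByCircuit n d s f = Σ (Levels n d 1) λ C → Σ Bool λ t →
  (size C ≤ s) × ((x : Input n) → f x ≡ evalL C t x Fin.zero)
  where import Data.Fin as Fin

{-# OPTIONS --safe #-}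
module Submission where

-- Each of the three criteria gives every single variable influence 1/2, so the total influence is n/2: PC and SAC by
-- restricting to singletons and averaging over restrictions, bentness by Plancherel applied to f and f(x^{⊕i}).
--
-- (1), (2): if f is increasing in the directions σ, its total influence is E[f·s] with s(x) = Σ σᵢxᵢ. Expanding
-- E[(s - 2f)²] > 0, with E[s²] = n, gives total influence < (n + 4)/4, hence n < 4.
--
-- (3): a random restriction that leaves each variable free with probability 1/q multiplies the expected total influence
-- by 1/q. By a switching lemma in the style of Furst, Saxe and Sipser, with q = n^Θ(1/d), with high probability all the
-- gates of one level acquire certificates of constant size in the restricted function. After d restrictions the output
-- has certificates of constant size, hence constant total influence, so that f itself has total influence
-- O(q^d) = o(n). Certificates play the role of both DNFs and CNFs, which makes the argument independent of syntax.

open import Defs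
open import Data.Bool using (Bool; true; false; not; _xor_; _∧_; _∨_; if_then_else_; f≤t; b≤b) renaming (_≤_ to _≤ᵇ_)
open import Data.Bool.ListAction using (and; or)
open import Data.Bool.Properties using (∨-zeroʳ; ∧-zeroʳ; ∨-conicalˡ; ∨-conicalʳ; not-involutive; xor-comm; xor-same; ≤-antisym)
open import Data.Empty using (⊥-elim)
open import Data.Fin using (Fin; zero; suc; _≟_)
open import Data.Fin.Subset using (_∪_; _∩_)
open import Data.Integer as ℤ using (ℤ; +_; -[1+_]; -_; ∣_∣)
import Data.Integer.Properties as ℤₚ
import Data.Integer.Tactic.RingSolver as ℤ-Solver
open import Data.List as List using (List; []; _∷_)
import Data.List.Properties as Listₚ
open import Data.Maybe using (Maybe; just; nothing; fromMaybe)
open import Data.Nat hiding (_≟_; _≤ᵇ_)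
open import Data.Nat.Properties hiding (_≟_; ≤-antisym)
open import Data.Nat.Tactic.RingSolver using (solve-∀)
open import Data.Product using (Σ; _×_; _,_; proj₁; proj₂)
open import Data.Rational as ℚ using (ℚ; 0ℚ)
import Data.Rational.Properties as ℚₚ
open import Data.Sum using (_⊎_; inj₁; inj₂)
open import Data.Unit using (⊤; tt)
open import Data.Vec using (Vec; []; _∷_; lookup; zipWith; replicate; tabulate)
open import Data.Vec.Functional using () renaming (_∷_ to _∷ᶠ_)
open import Data.Vec.Properties using (lookup∘tabulate; lookup-replicate)
open import Function using (_∘_; id)
open import Relation.Nullary using (¬_; Dec; yes; no)
open import Relation.Nullary.Decidable using (does)
open import Relation.Binary.PropositionalEquality

-- Total influence suits the iteration because restricting scales its mean by exactly 1/q. Only q^d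
-- times a constant has to stay below n/2, so the switching lemma may be wasteful: certificate sizes
-- may grow very fast with d as long as they do not depend on n. A failure probability below the
-- inverse of (number of gates) · n · q suffices, since a bad restriction costs at most the trivial
-- influence n. Probabilities are kept as natural numbers: a restriction has weight r to the number
-- of its fixed variables, the total weight is q^n with q = 1 + 2r, and inequalities are multiplied
-- out. A restricted function still takes all n arguments, the fixed ones being dummy, so n stays
-- the same through all d rounds. Inputs in the definitions are functions, and a `BoolFun` may a
-- priori distinguish inputs with equal values. Sums are therefore taken over vectors, and each of
-- the three classes has to supply the fact that its members respect pointwise equality (`Ext`).

ind : Bool → ℕ
ind true  = 1
ind false = 0

-- Weighted sums over vectors

record Weighting (C : Set) : Set where
  field
    weigh  : (C → ℕ) → ℕ
    w-cong : ∀ {F G} → (∀ c → F c ≡ G c) → weigh F ≡ weigh G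
    w-mono : ∀ {F G} → (∀ c → F c ≤ G c) → weigh F ≤ weigh G
    w-+    : ∀ F G → weigh (λ c → F c + G c) ≡ weigh F + weigh G
    w-*    : ∀ k F → weigh (λ c → k * F c) ≡ k * weigh F

open Weighting

∑ : ∀ {C} → Weighting C → ∀ {n} → (Vec C n → ℕ) → ℕ
∑ w {zero}  F = F []
∑ w {suc n} F = weigh w (λ c → ∑ w (λ v → F (c ∷ v)))

∑-cong : ∀ {C} (w : Weighting C) {n} {F G : Vec C n → ℕ} → (∀ v → F v ≡ G v) → ∑ w F ≡ ∑ w G
∑-cong w {zero}  h = h []
∑-cong w {suc n} h = w-cong w (λ c → ∑-cong w (λ v → h (c ∷ v)))

∑-mono : ∀ {C} (w : Weighting C) {n} {F G : Vec C n → ℕ} → (∀ v → F v ≤ G v) → ∑ w F ≤ ∑ w G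
∑-mono w {zero}  h = h []
∑-mono w {suc n} h = w-mono w (λ c → ∑-mono w (λ v → h (c ∷ v)))

∑-+ : ∀ {C} (w : Weighting C) {n} (F G : Vec C n → ℕ) → ∑ w (λ v → F v + G v) ≡ ∑ w F + ∑ w G
∑-+ w {zero}  F G = refl
∑-+ w {suc n} F G = trans
  (w-cong w (λ c → ∑-+ w (λ v → F (c ∷ v)) (λ v → G (c ∷ v))))
  (w-+ w (λ c → ∑ w (λ v → F (c ∷ v))) (λ c → ∑ w (λ v → G (c ∷ v))))

∑-* : ∀ {C} (w : Weighting C) {n} k (F : Vec C n → ℕ) → ∑ w (λ v → k * F v) ≡ k * ∑ w F
∑-* w {zero}  k F = refl
∑-* w {suc n} k F = trans
  (w-cong w (λ c → ∑-* w k (λ v → F (c ∷ v))))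
  (w-* w k (λ c → ∑ w (λ v → F (c ∷ v))))

∑-const : ∀ {C} (w : Weighting C) n k → ∑ w {n} (λ _ → k) ≡ k * weigh w (λ _ → 1) ^ n
∑-const w zero    k = sym (*-identityʳ k)
∑-const w (suc n) k = begin
  weigh w (λ c → ∑ w {n} (λ _ → k))        ≡⟨ w-cong w (λ c → trans (∑-const w n k) (sym (*-identityʳ _))) ⟩
  weigh w (λ c → k * q ^ n * 1)            ≡⟨ w-* w (k * q ^ n) (λ _ → 1) ⟩
  k * q ^ n * q                            ≡⟨ eq k (q ^ n) q ⟩
  k * (q * q ^ n)                          ∎
  where
    open ≡-Reasoning
    q = weigh w (λ _ → 1)
    eq : ∀ a b c → a * b * c ≡ a * (c * b)
    eq = solve-∀

bits : Weighting Bool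
bits = record
  { weigh  = λ F → F true + F false
  ; w-cong = λ h → cong₂ _+_ (h true) (h false)
  ; w-mono = λ h → +-mono-≤ (h true) (h false)
  ; w-+    = λ F G → eq (F true) (F false) (G true) (G false)
  ; w-*    = λ k F → sym (*-distribˡ-+ k (F true) (F false))
  }
  where
    eq : ∀ a b c d → (a + c) + (b + d) ≡ (a + b) + (c + d)
    eq = solve-∀

-- A coordinate stays free with weight 1 and takes each of the two values with weight r.
stars : ℕ → Weighting (Maybe Bool)
stars r = record
  { weigh  = λ F → F nothing + r * (F (just true) + F (just false))
  ; w-cong = λ h → cong₂ _+_ (h nothing) (cong (r *_) (cong₂ _+_ (h (just true)) (h (just false))))
  ; w-mono = λ h → +-mono-≤ (h nothing) (*-monoʳ-≤ r (+-mono-≤ (h (just true)) (h (just false))))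
  ; w-+    = λ F G → eq₁ r (F nothing) (F (just true)) (F (just false))
                            (G nothing) (G (just true)) (G (just false))
  ; w-*    = λ k F → eq₂ r k (F nothing) (F (just true)) (F (just false))
  }
  where
    eq₁ : ∀ r a b c a′ b′ c′ → (a + a′) + r * ((b + b′) + (c + c′)) ≡ (a + r * (b + c)) + (a′ + r * (b′ + c′))
    eq₁ = solve-∀
    eq₂ : ∀ r k a b c → k * a + r * (k * b + k * c) ≡ k * (a + r * (b + c))
    eq₂ = solve-∀

-- Restrictions and total influence

Fun : ℕ → Set
Fun n = Vec Bool n → Bool

Restriction : ℕ → Set
Restriction n = Vec (Maybe Bool) n

_▹_ : ∀ {n} → Restriction n → Vec Bool n → Vec Bool n
_▹_ = zipWith (λ c b → fromMaybe b c)

_∣_ : ∀ {n} → Fun n → Restriction n → Fun n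
(f ∣ ρ) x = f (ρ ▹ x)

sens : ∀ {n} → Fun n → Vec Bool n → ℕ
sens f []      = 0
sens f (b ∷ x) = ind (f (b ∷ x) xor f (not b ∷ x)) + sens (f ∘ (b ∷_)) x

-- 2ⁿ times the total influence.
N : ∀ {n} → Fun n → ℕ
N f = ∑ bits (sens f)

#stars : ℕ → ℕ
#stars r = 1 + r * 2

-- A free coordinate lets x supply each value once; a fixed one supplies its own value with weight r
-- for both choices of x. Every value of a coordinate of `ρ ▹ x` thus has weight 1 + 2r, and the
-- completed point is uniform.
∑-▹ : ∀ r {n} (F : Vec Bool n → ℕ) → ∑ (stars r) (λ ρ → ∑ bits (λ x → F (ρ ▹ x))) ≡ #stars r ^ n * ∑ bits F
∑-▹ r {zero}  F = sym (+-identityʳ _)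
∑-▹ r {suc n} F = begin
  ∑ (stars r) (λ ρ → X true ρ + X false ρ)
    + r * (∑ (stars r) (λ ρ → X true ρ + X true ρ) + ∑ (stars r) (λ ρ → X false ρ + X false ρ))
    ≡⟨ cong₂ _+_ (split true false) (cong (r *_) (cong₂ _+_ (split true true) (split false false))) ⟩
  (Q * s true + Q * s false) + r * ((Q * s true + Q * s true) + (Q * s false + Q * s false))
    ≡⟨ eq r Q (s true) (s false) ⟩
  #stars r * Q * (s true + s false) ∎
  where
    open ≡-Reasoning
    Q = #stars r ^ n
    s : Bool → ℕ
    s b = ∑ bits (λ x → F (b ∷ x))
    X : Bool → Restriction n → ℕ
    X b ρ = ∑ bits (λ x → F (b ∷ (ρ ▹ x)))
    split : ∀ b c → ∑ (stars r) (λ ρ → X b ρ + X c ρ) ≡ Q * s b + Q * s c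
    split b c = trans (∑-+ (stars r) (X b) (X c))
                      (cong₂ _+_ (∑-▹ r (λ x → F (b ∷ x))) (∑-▹ r (λ x → F (c ∷ x))))
    eq : ∀ r Q a b → (Q * a + Q * b) + r * ((Q * a + Q * a) + (Q * b + Q * b)) ≡ (1 + r * 2) * Q * (a + b)
    eq = solve-∀

diff : ∀ {n} → Fun n → Fun n → ℕ
diff f g = ∑ bits (λ x → ind (f x xor g x))

diff-self : ∀ {n} (f : Fun n) → diff f f ≡ 0
diff-self {n} f = trans (∑-cong bits (λ x → cong ind (xor-same (f x)))) (∑-const bits n 0)

-- Each edge in the first direction is counted from both of its ends, hence the factor 2.
N-suc : ∀ {n} (f : Fun (suc n)) →
  N f ≡ N (f ∘ (true ∷_)) + N (f ∘ (false ∷_)) + 2 * diff (f ∘ (true ∷_)) (f ∘ (false ∷_))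
N-suc f = begin
  N f
    ≡⟨ cong₂ _+_ (∑-+ bits _ (sens (f ∘ (true ∷_)))) (∑-+ bits _ (sens (f ∘ (false ∷_)))) ⟩
  (diff (f ∘ (true ∷_)) (f ∘ (false ∷_)) + N (f ∘ (true ∷_)))
    + (diff (f ∘ (false ∷_)) (f ∘ (true ∷_)) + N (f ∘ (false ∷_)))
    ≡⟨ cong (λ z → (diff (f ∘ (true ∷_)) (f ∘ (false ∷_)) + N (f ∘ (true ∷_))) + (z + N (f ∘ (false ∷_))))
            (∑-cong bits (λ x → cong ind (xor-comm (f (false ∷ x)) (f (true ∷ x))))) ⟩
  (diff (f ∘ (true ∷_)) (f ∘ (false ∷_)) + N (f ∘ (true ∷_)))
    + (diff (f ∘ (true ∷_)) (f ∘ (false ∷_)) + N (f ∘ (false ∷_)))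
    ≡⟨ eq (diff (f ∘ (true ∷_)) (f ∘ (false ∷_))) (N (f ∘ (true ∷_))) (N (f ∘ (false ∷_))) ⟩
  _ ∎
  where
    open ≡-Reasoning
    eq : ∀ d a b → (d + a) + (d + b) ≡ a + b + 2 * d
    eq = solve-∀

-- Edges in direction i survive only when i is free, which has probability 1/q, and the other
-- coordinates of the completed point are then uniform. The factor q on the left replaces a
-- division.
∑-N-restrict : ∀ r {n} (f : Fun n) → #stars r * ∑ (stars r) (λ ρ → N (f ∣ ρ)) ≡ #stars r ^ n * N f
∑-N-restrict r {zero}  f = trans (*-zeroʳ (#stars r)) (sym (+-identityʳ 0))
∑-N-restrict r {suc n} f = begin
  q * (∑ (stars r) (λ ρ → N (f ∣ (nothing ∷ ρ)))
        + r * (∑ (stars r) (λ ρ → N (f ∣ (just true ∷ ρ))) + ∑ (stars r) (λ ρ → N (f ∣ (just false ∷ ρ)))))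
    ≡⟨ cong (q *_) (cong₂ _+_ free (cong (r *_) (cong₂ _+_ (fixed true) (fixed false)))) ⟩
  q * ((S true + S false + 2 * (Q * D)) + r * ((2 * S true) + (2 * S false)))
    ≡⟨ eq₁ r (S true) (S false) Q D ⟩
  q * (q * S true + q * S false) + q * (2 * (Q * D))
    ≡⟨ cong (λ z → q * z + q * (2 * (Q * D))) (cong₂ _+_ (∑-N-restrict r (part true)) (∑-N-restrict r (part false))) ⟩
  q * (Q * N (part true) + Q * N (part false)) + q * (2 * (Q * D))
    ≡⟨ eq₂ q Q (N (part true)) (N (part false)) D ⟩
  q * Q * (N (part true) + N (part false) + 2 * D)
    ≡⟨ cong (q * Q *_) (sym (N-suc f)) ⟩
  q * Q * N f ∎
  where
    open ≡-Reasoning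
    q = #stars r
    Q = q ^ n
    part : Bool → Fun n
    part b = f ∘ (b ∷_)
    D = diff (part true) (part false)
    S : Bool → ℕ
    S b = ∑ (stars r) (λ ρ → N (part b ∣ ρ))
    free : ∑ (stars r) (λ ρ → N (f ∣ (nothing ∷ ρ))) ≡ S true + S false + 2 * (Q * D)
    free = begin
      ∑ (stars r) (λ ρ → N (f ∣ (nothing ∷ ρ)))
        ≡⟨ ∑-cong (stars r) (λ ρ → N-suc (f ∣ (nothing ∷ ρ))) ⟩
      ∑ (stars r) (λ ρ → N (part true ∣ ρ) + N (part false ∣ ρ) + 2 * diff (part true ∣ ρ) (part false ∣ ρ))
        ≡⟨ ∑-+ (stars r) _ (λ ρ → 2 * diff (part true ∣ ρ) (part false ∣ ρ)) ⟩
      ∑ (stars r) (λ ρ → N (part true ∣ ρ) + N (part false ∣ ρ))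
        + ∑ (stars r) (λ ρ → 2 * diff (part true ∣ ρ) (part false ∣ ρ))
        ≡⟨ cong₂ _+_ (∑-+ (stars r) (λ ρ → N (part true ∣ ρ)) (λ ρ → N (part false ∣ ρ)))
                     (trans (∑-* (stars r) 2 (λ ρ → diff (part true ∣ ρ) (part false ∣ ρ)))
                            (cong (2 *_) (∑-▹ r (λ x → ind (part true x xor part false x))))) ⟩
      S true + S false + 2 * (Q * D) ∎
    -- Over a fixed first coordinate the two halves are the same function, so the edges between them
    -- vanish and the rest is counted twice.
    fixed : ∀ b → ∑ (stars r) (λ ρ → N (f ∣ (just b ∷ ρ))) ≡ 2 * S b
    fixed b = trans
      (∑-cong (stars r) (λ ρ → begin
        N (f ∣ (just b ∷ ρ))
          ≡⟨ N-suc (f ∣ (just b ∷ ρ)) ⟩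
        N (part b ∣ ρ) + N (part b ∣ ρ) + 2 * diff (part b ∣ ρ) (part b ∣ ρ)
          ≡⟨ cong (λ z → N (part b ∣ ρ) + N (part b ∣ ρ) + 2 * z) (diff-self (part b ∣ ρ)) ⟩
        N (part b ∣ ρ) + N (part b ∣ ρ) + 0
          ≡⟨ eq₃ (N (part b ∣ ρ)) ⟩
        2 * N (part b ∣ ρ) ∎))
      (∑-* (stars r) 2 (λ ρ → N (part b ∣ ρ)))
      where
        eq₃ : ∀ a → a + a + 0 ≡ 2 * a
        eq₃ = solve-∀
    eq₁ : ∀ r a b Q D → (1 + r * 2) * ((a + b + 2 * (Q * D)) + r * ((2 * a) + (2 * b)))
                      ≡ (1 + r * 2) * ((1 + r * 2) * a + (1 + r * 2) * b) + (1 + r * 2) * (2 * (Q * D))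
    eq₁ = solve-∀
    eq₂ : ∀ q Q a b D → q * (Q * a + Q * b) + q * (2 * (Q * D)) ≡ q * Q * (a + b + 2 * D)
    eq₂ = solve-∀

-- Certificates

∥_∥ : ∀ {n} → Vec Bool n → ℕ
∥ [] ∥    = 0
∥ b ∷ m ∥ = ind b + ∥ m ∥

-- Generic in `A` because both points and restrictions are compared on masks.
data Agree {A : Set} : ∀ {n} → Vec Bool n → Vec A n → Vec A n → Set where
  []   : Agree [] [] []
  keep : ∀ {n} {m : Vec Bool n} {xs ys} a → Agree m xs ys → Agree (true ∷ m) (a ∷ xs) (a ∷ ys)
  skip : ∀ {n} {m : Vec Bool n} {xs ys} a b → Agree m xs ys → Agree (false ∷ m) (a ∷ xs) (b ∷ ys)

agree-refl : ∀ {A : Set} {n} (m : Vec Bool n) (x : Vec A n) → Agree m x x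
agree-refl []          []      = []
agree-refl (true ∷ m)  (a ∷ x) = keep a (agree-refl m x)
agree-refl (false ∷ m) (a ∷ x) = skip a a (agree-refl m x)

agree-∷ : ∀ {A : Set} {n} {m : Vec Bool n} {x y : Vec A n} b a → Agree m x y → Agree (b ∷ m) (a ∷ x) (a ∷ y)
agree-∷ true  a h = keep a h
agree-∷ false a h = skip a a h

-- For v = true this says that f is a DNF of width b, for v = false a CNF.
Certified : Bool → ∀ {n} → Fun n → ℕ → Set
Certified v f b = ∀ x → f x ≡ v → Σ (Vec Bool _) λ m → ∥ m ∥ ≤ b × (∀ y → Agree m x y → f y ≡ v)

-- Flipping a coordinate outside the mask preserves agreement and hence the value, so every
-- sensitive coordinate lies in the mask.
sens-≤-cert : ∀ {n} (f : Fun n) x m v → (∀ y → Agree m x y → f y ≡ v) → sens f x ≤ ∥ m ∥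
sens-≤-cert f [] [] v h = z≤n
sens-≤-cert f (b ∷ x) (true ∷ m) v h =
  +-mono-≤ (ind≤1 (f (b ∷ x) xor f (not b ∷ x))) (sens-≤-cert (f ∘ (b ∷_)) x m v (λ y a → h (b ∷ y) (keep b a)))
  where
    ind≤1 : ∀ b → ind b ≤ 1
    ind≤1 true  = ≤-refl
    ind≤1 false = z≤n
sens-≤-cert f (b ∷ x) (false ∷ m) v h
  rewrite h (b ∷ x) (agree-refl (false ∷ m) (b ∷ x)) | h (not b ∷ x) (skip b (not b) (agree-refl m x)) | xor-same v
  = sens-≤-cert (f ∘ (b ∷_)) x m v (λ y a → h (b ∷ y) (skip b b a))

N-≤-cert : ∀ {n} (f : Fun n) b → (∀ v → Certified v f b) → N f ≤ b * 2 ^ n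
N-≤-cert {n} f b c = ≤-trans
  (∑-mono bits (λ x → ≤-trans (sens-≤-cert f x (proj₁ (c (f x) x refl)) (f x) (proj₂ (proj₂ (c (f x) x refl))))
                              (proj₁ (proj₂ (c (f x) x refl)))))
  (≤-reflexive (∑-const bits n b))

all-agree : ∀ {n} (x y : Vec Bool n) → Agree (replicate n true) x y → x ≡ y
all-agree []      []      []         = refl
all-agree (a ∷ x) (a ∷ y) (keep a h) = cong (a ∷_) (all-agree x y h)

∥all∥ : ∀ n → ∥ replicate n true ∥ ≡ n
∥all∥ zero    = refl
∥all∥ (suc n) = cong suc (∥all∥ n)

-- The certificate that reads every variable; this crude bound is what a bad restriction is charged.
N-≤ : ∀ {n} (f : Fun n) → N f ≤ n * 2 ^ n
N-≤ {n} f = N-≤-cert f n (λ v x p → replicate n true , ≤-reflexive (∥all∥ n) ,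
  λ y h → trans (sym (cong f (all-agree x y h))) p)

certified-mono : ∀ {v n} {f : Fun n} {b b′} → b ≤ b′ → Certified v f b → Certified v f b′
certified-mono le c x p with c x p
... | m , m≤ , h = m , ≤-trans m≤ le , h

agree-▹ : ∀ {n} {m : Vec Bool n} {x y} (ρ : Restriction n) → Agree m x y → Agree m (ρ ▹ x) (ρ ▹ y)
agree-▹ []            []           = []
agree-▹ (c ∷ ρ)       (keep a h)   = keep _ (agree-▹ ρ h)
agree-▹ (c ∷ ρ)       (skip a b h) = skip _ _ (agree-▹ ρ h)

certified-∣ : ∀ {v n} {f : Fun n} {b} (ρ : Restriction n) → Certified v f b → Certified v (f ∣ ρ) b
certified-∣ ρ c x p with c (ρ ▹ x) p
... | m , m≤ , h = m , m≤ , λ y a → h (ρ ▹ y) (agree-▹ ρ a)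

certified-not : ∀ {v n} {f : Fun n} {b} → Certified v f b → Certified (not v) (not ∘ f) b
certified-not {v} {f = f} c x p with c x (trans (sym (not-involutive (f x))) (trans (cong not p) (not-involutive v)))
... | m , m≤ , h = m , m≤ , λ y a → cong not (h y a)

-- `not t` is the value that a single input can force on a gate of type `t`. The certificate of that
-- input serves the gate, whatever the fan-in.
certified-gate : ∀ t {n b} {J : Set} (g : J → Fun n) → (∀ j → Certified (not t) (g j) b) →
  ∀ js → Certified (not t) (λ x → gate t (List.map (λ j → g j x) js)) b
certified-gate true  g c [] x ()
certified-gate false g c [] x ()
certified-gate true g c (j ∷ js) x p with g j x in eq
... | false with c j x eq
...   | m , m≤ , h = m , m≤ , λ y a → cong (_∧ and (List.map (λ i → g i y) js)) (h y a)
certified-gate true g c (j ∷ js) x p | true with certified-gate true g c js x p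
...   | m , m≤ , h = m , m≤ , λ y a → trans (cong (g j y ∧_) (h y a)) (∧-zeroʳ (g j y))
certified-gate false g c (j ∷ js) x p with g j x in eq
... | true with c j x eq
...   | m , m≤ , h = m , m≤ , λ y a → cong (_∨ or (List.map (λ i → g i y) js)) (h y a)
certified-gate false g c (j ∷ js) x p | false with certified-gate false g c js x p
...   | m , m≤ , h = m , m≤ , λ y a → trans (cong (g j y ∨_) (h y a)) (∨-zeroʳ (g j y))

-- Set operations on masks

_∖_ : ∀ {n} → Vec Bool n → Vec Bool n → Vec Bool n
_∖_ = zipWith (λ a b → a ∧ not b)

meets : ∀ {n} → Vec Bool n → Vec Bool n → Bool
meets []      []       = false
meets (a ∷ m) (b ∷ m′) = (a ∧ b) ∨ meets m m′

∥∪∥≤ : ∀ {n} (m m′ : Vec Bool n) → ∥ m ∪ m′ ∥ ≤ ∥ m ∥ + ∥ m′ ∥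
∥∪∥≤ []      []       = z≤n
∥∪∥≤ (true ∷ m)  (b ∷ m′)     = s≤s (≤-trans (∥∪∥≤ m m′) (+-monoʳ-≤ ∥ m ∥ (m≤n+m ∥ m′ ∥ (ind b))))
∥∪∥≤ (false ∷ m) (true ∷ m′)  = ≤-trans (s≤s (∥∪∥≤ m m′)) (≤-reflexive (sym (+-suc ∥ m ∥ ∥ m′ ∥)))
∥∪∥≤ (false ∷ m) (false ∷ m′) = ∥∪∥≤ m m′

∥∖∥≤ : ∀ {n} (c m : Vec Bool n) → ∥ c ∖ m ∥ ≤ ∥ c ∥
∥∖∥≤ []          []          = z≤n
∥∖∥≤ (true ∷ c)  (true ∷ m)  = m≤n⇒m≤1+n (∥∖∥≤ c m)
∥∖∥≤ (true ∷ c)  (false ∷ m) = s≤s (∥∖∥≤ c m)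
∥∖∥≤ (false ∷ c) (_ ∷ m)     = ∥∖∥≤ c m

∥∖∥< : ∀ {n} (c m : Vec Bool n) → meets c m ≡ true → ∥ c ∖ m ∥ < ∥ c ∥
∥∖∥< []          []          ()
∥∖∥< (true ∷ c)  (true ∷ m)  h = s≤s (∥∖∥≤ c m)
∥∖∥< (true ∷ c)  (false ∷ m) h = s≤s (∥∖∥< c m h)
∥∖∥< (false ∷ c) (_ ∷ m)     h = ∥∖∥< c m h

agree-∪ˡ : ∀ {A : Set} {n} (m m′ : Vec Bool n) {x y : Vec A n} → Agree (m ∪ m′) x y → Agree m x y
agree-∪ˡ []          []           []           = []
agree-∪ˡ (true ∷ m)  (b ∷ m′)     (keep a h)   = keep a (agree-∪ˡ m m′ h)
agree-∪ˡ (false ∷ m) (true ∷ m′)  (keep a h)   = skip a a (agree-∪ˡ m m′ h)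
agree-∪ˡ (false ∷ m) (false ∷ m′) (skip a b h) = skip a b (agree-∪ˡ m m′ h)

agree-∪ʳ : ∀ {A : Set} {n} (m m′ : Vec Bool n) {x y : Vec A n} → Agree (m ∪ m′) x y → Agree m′ x y
agree-∪ʳ []          []           []           = []
agree-∪ʳ (true ∷ m)  (true ∷ m′)  (keep a h)   = keep a (agree-∪ʳ m m′ h)
agree-∪ʳ (true ∷ m)  (false ∷ m′) (keep a h)   = skip a a (agree-∪ʳ m m′ h)
agree-∪ʳ (false ∷ m) (true ∷ m′)  (keep a h)   = keep a (agree-∪ʳ m m′ h)
agree-∪ʳ (false ∷ m) (false ∷ m′) (skip a b h) = skip a b (agree-∪ʳ m m′ h)

override : ∀ {n} → Vec Bool n → Vec Bool n → Vec Bool n → Vec Bool n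
override []          []      []      = []
override (true ∷ m)  (b ∷ β) (_ ∷ y) = b ∷ override m β y
override (false ∷ m) (_ ∷ β) (a ∷ y) = a ∷ override m β y

override-∩ : ∀ {n} (m z : Vec Bool n) → override m (m ∩ z) z ≡ z
override-∩ []          []      = refl
override-∩ (true ∷ m)  (a ∷ z) = cong (a ∷_) (override-∩ m z)
override-∩ (false ∷ m) (a ∷ z) = cong (a ∷_) (override-∩ m z)

agree-override : ∀ {n} (c m β : Vec Bool n) {x y} → Agree (c ∖ m) x y → Agree c (override m β x) (override m β y)
agree-override []          []          []      []           = []
agree-override (true ∷ c)  (true ∷ m)  (b ∷ β) (skip _ _ h) = keep b (agree-override c m β h)
agree-override (true ∷ c)  (false ∷ m) (_ ∷ β) (keep a h)   = keep a (agree-override c m β h)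
agree-override (false ∷ c) (true ∷ m)  (b ∷ β) (skip _ _ h) = skip b b (agree-override c m β h)
agree-override (false ∷ c) (false ∷ m) (_ ∷ β) (skip a b h) = skip a b (agree-override c m β h)

-- A certificate of `f` at the overridden point remains valid after its coordinates in `m` are
-- dropped, since `β` supplies those. Meeting `m` means that at least one is dropped: this is how
-- the width goes down in the induction.
certified-override : ∀ {n} {f : Fun n} {b} (c : Certified true f (suc b)) (m β : Vec Bool n) →
  (∀ x p → meets (proj₁ (c x p)) m ≡ true) → Certified true (λ y → f (override m β y)) b
certified-override c m β hit y p with c (override m β y) p | hit (override m β y) p
... | k , k≤ , h | mt = k ∖ m , s≤s⁻¹ (≤-trans (∥∖∥< k m mt) k≤) , λ z a → h (override m β z) (agree-override k m β a)

-- Exhausting the cube makes the choice between extending a disjoint family and stopping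
-- constructive.
search : ∀ {n} (P : Fun n) → (Σ (Vec Bool n) λ x → P x ≡ true) ⊎ (∀ x → P x ≡ false)
search {zero} P with P [] in eq
... | true  = inj₁ ([] , eq)
... | false = inj₂ λ { [] → eq }
search {suc n} P with search (P ∘ (true ∷_)) | search (P ∘ (false ∷_))
... | inj₁ (x , p) | _            = inj₁ (true ∷ x , p)
... | inj₂ _       | inj₁ (x , p) = inj₁ (false ∷ x , p)
... | inj₂ p       | inj₂ q       = inj₂ λ { (true ∷ x) → p x ; (false ∷ x) → q x }

-- Counting restrictions

#ρ : ℕ → ∀ {n} → (Restriction n → Bool) → ℕ
#ρ r A = ∑ (stars r) (ind ∘ A)

-- A free variable matches nothing: a certificate counts as satisfied only when the restriction
-- itself fixes all of it.
match : Bool → Maybe Bool → Bool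
match b     nothing      = false
match true  (just true)  = true
match true  (just false) = false
match false (just true)  = false
match false (just false) = true

forced : ∀ {n} → Vec Bool n → Vec Bool n → Restriction n → Bool
forced []          []      []      = true
forced (true ∷ m)  (b ∷ x) (c ∷ ρ) = match b c ∧ forced m x ρ
forced (false ∷ m) (b ∷ x) (c ∷ ρ) = forced m x ρ

forced-agree : ∀ {n} (m x : Vec Bool n) ρ → forced m x ρ ≡ true → ∀ y → Agree m x (ρ ▹ y)
forced-agree []          []          []               h []      = []
forced-agree (true ∷ m)  (true ∷ x)  (just true ∷ ρ)  h (_ ∷ y) = keep true (forced-agree m x ρ h y)
forced-agree (true ∷ m)  (false ∷ x) (just false ∷ ρ) h (_ ∷ y) = keep false (forced-agree m x ρ h y)
forced-agree (false ∷ m) (b ∷ x)     (c ∷ ρ)          h (_ ∷ y) = skip b _ (forced-agree m x ρ h y)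

forced-depends : ∀ {n} (m x : Vec Bool n) {ρ ρ′} → Agree m ρ ρ′ → forced m x ρ ≡ forced m x ρ′
forced-depends []          []      []           = refl
forced-depends (true ∷ m)  (b ∷ x) (keep c h)   = cong (match b c ∧_) (forced-depends m x h)
forced-depends (false ∷ m) (b ∷ x) (skip _ _ h) = forced-depends m x h

-- A statistic that does not look at m is independent of the event that ρ agrees with x on m,
-- which has probability (r / (1 + 2r)) ^ ∥ m ∥ ≥ 3 ^ (- ∥ m ∥).
forced-indep : ∀ r → 1 ≤ r → ∀ {n} (m x V : Vec Bool n) (F : Restriction n → ℕ) → meets m V ≡ false →
  (∀ {ρ ρ′} → Agree V ρ ρ′ → F ρ ≡ F ρ′) →
  ∑ (stars r) F ≤ 3 ^ ∥ m ∥ * ∑ (stars r) (λ ρ → ind (forced m x ρ) * F ρ)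
forced-indep r 1≤r [] [] [] F _ dep = ≤-reflexive (eq (F []))
  where
    eq : ∀ a → a ≡ 1 * (1 * a)
    eq = solve-∀
forced-indep r 1≤r (false ∷ m) (b ∷ x) (v ∷ V) F disj dep = ≤-trans
  (w-mono (stars r) (λ c → forced-indep r 1≤r m x V (λ ρ → F (c ∷ ρ)) disj (λ a → dep (agree-∷ v c a))))
  (≤-reflexive (w-* (stars r) (3 ^ ∥ m ∥) (λ c → ∑ (stars r) (λ ρ → ind (forced m x ρ) * F (c ∷ ρ)))))
forced-indep r 1≤r {suc n} (true ∷ m) (b ∷ x) (false ∷ V) F disj dep = begin
  G nothing + r * (G (just true) + G (just false))
    ≡⟨ cong₂ (λ u v → G nothing + r * (u + v)) (same (just true)) (same (just false)) ⟩
  G nothing + r * (G nothing + G nothing)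
    -- Here 1 + 2r ≤ 3r is used; this is the origin of the base 3.
    ≤⟨ +-monoˡ-≤ _ (≤-trans (≤-reflexive (sym (*-identityˡ (G nothing)))) (*-monoˡ-≤ (G nothing) 1≤r)) ⟩
  r * G nothing + r * (G nothing + G nothing)
    ≡⟨ eq₁ r (G nothing) ⟩
  3 * r * G nothing
    ≤⟨ *-monoʳ-≤ (3 * r) (forced-indep r 1≤r m x V (λ ρ → F (nothing ∷ ρ)) disj (λ a → dep (skip _ _ a))) ⟩
  3 * r * (3 ^ ∥ m ∥ * H)
    ≡⟨ eq₂ r (3 ^ ∥ m ∥) H ⟩
  3 * 3 ^ ∥ m ∥ * (r * H)
    ≡⟨ cong (3 * 3 ^ ∥ m ∥ *_) (sym (total b)) ⟩
  3 * 3 ^ ∥ m ∥ * (K b nothing + r * (K b (just true) + K b (just false))) ∎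
  where
    open ≤-Reasoning
    G : Maybe Bool → ℕ
    G c = ∑ (stars r) (λ ρ → F (c ∷ ρ))
    same : ∀ c → G c ≡ G nothing
    same c = ∑-cong (stars r) (λ ρ → dep (skip c nothing (agree-refl V ρ)))
    H = ∑ (stars r) (λ ρ → ind (forced m x ρ) * F (nothing ∷ ρ))
    K : Bool → Maybe Bool → ℕ
    K b c = ∑ (stars r) (λ ρ → ind (match b c ∧ forced m x ρ) * F (c ∷ ρ))
    yes-K : ∀ b c → match b c ≡ true → K b c ≡ H
    yes-K b c p = ∑-cong (stars r) λ ρ →
      cong₂ (λ u v → ind (u ∧ forced m x ρ) * v) p (dep (skip c nothing (agree-refl V ρ)))
    no-K : ∀ b c → match b c ≡ false → K b c ≡ 0
    no-K b c p = trans (∑-cong (stars r) {n} λ ρ → cong (λ u → ind (u ∧ forced m x ρ) * F (c ∷ ρ)) p)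
                       (∑-const (stars r) n 0)
    total : ∀ b → K b nothing + r * (K b (just true) + K b (just false)) ≡ r * H
    total true = cong₂ _+_ (no-K true nothing refl) (cong (r *_)
      (trans (cong₂ _+_ (yes-K true (just true) refl) (no-K true (just false) refl)) (+-identityʳ H)))
    total false = cong₂ _+_ (no-K false nothing refl) (cong (r *_)
      (cong₂ _+_ (no-K false (just true) refl) (yes-K false (just false) refl)))
    eq₁ : ∀ r g → r * g + r * (g + g) ≡ 3 * r * g
    eq₁ = solve-∀
    eq₂ : ∀ r t h → 3 * r * (t * h) ≡ 3 * t * (r * h)
    eq₂ = solve-∀

manyStars : ∀ {n} → ℕ → Vec Bool n → Restriction n → Bool
manyStars zero    m           ρ             = true
manyStars (suc a) []          []            = false
manyStars (suc a) (true ∷ m)  (nothing ∷ ρ) = manyStars a m ρ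
manyStars (suc a) (true ∷ m)  (just _ ∷ ρ)  = manyStars (suc a) m ρ
manyStars (suc a) (false ∷ m) (_ ∷ ρ)       = manyStars (suc a) m ρ

-- In effect a union bound over the at most `∥ m ∥ ^ a` ordered choices of positions, each wholly
-- free with probability q^-a, carried out as a recursion on coordinates.
#manyStars : ∀ r {n} a (m : Vec Bool n) → #stars r ^ a * #ρ r (manyStars a m) ≤ ∥ m ∥ ^ a * #stars r ^ n
#manyStars r {n} zero m = *-monoʳ-≤ 1 (≤-reflexive (trans (∑-const (stars r) n 1) (*-identityˡ _)))
#manyStars r (suc a) [] = ≤-trans (≤-reflexive (*-zeroʳ (#stars r ^ suc a))) z≤n
#manyStars r {suc n} (suc a) (false ∷ m) = begin
  Qa * (Z + r * (Z + Z))         ≡⟨ eq₁ Qa Z r ⟩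
  #stars r * (Qa * Z)            ≤⟨ *-monoʳ-≤ (#stars r) (#manyStars r (suc a) m) ⟩
  #stars r * (∥ m ∥ ^ suc a * T) ≡⟨ eq₂ (#stars r) (∥ m ∥ ^ suc a) T ⟩
  ∥ m ∥ ^ suc a * (#stars r * T) ∎
  where
    open ≤-Reasoning
    Qa = #stars r ^ suc a
    T = #stars r ^ n
    Z = #ρ r (manyStars (suc a) m)
    eq₁ : ∀ q z r → q * (z + r * (z + z)) ≡ (1 + r * 2) * (q * z)
    eq₁ = solve-∀
    eq₂ : ∀ a b c → a * (b * c) ≡ b * (a * c)
    eq₂ = solve-∀
#manyStars r {suc n} (suc a) (true ∷ m) = begin
  q * q ^ a * (Y + r * (Z + Z))
    ≡⟨ eq₁ q (q ^ a) Y Z r ⟩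
  q * (q ^ a * Y) + (r * 2) * (q * q ^ a * Z)
    ≤⟨ +-mono-≤ (*-monoʳ-≤ q (#manyStars r a m)) (*-monoʳ-≤ (r * 2) (#manyStars r (suc a) m)) ⟩
  q * (∥ m ∥ ^ a * T) + (r * 2) * (∥ m ∥ * ∥ m ∥ ^ a * T)
    ≤⟨ +-monoʳ-≤ (q * (∥ m ∥ ^ a * T)) (*-monoˡ-≤ (∥ m ∥ * ∥ m ∥ ^ a * T) (n≤1+n (r * 2))) ⟩
  q * (∥ m ∥ ^ a * T) + q * (∥ m ∥ * ∥ m ∥ ^ a * T)
    ≡⟨ eq₂ q ∥ m ∥ (∥ m ∥ ^ a) T ⟩
  suc ∥ m ∥ * ∥ m ∥ ^ a * (q * T)
    ≤⟨ *-monoˡ-≤ (q * T) (*-monoʳ-≤ (suc ∥ m ∥) (^-monoˡ-≤ a (n≤1+n ∥ m ∥))) ⟩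
  suc ∥ m ∥ * suc ∥ m ∥ ^ a * (q * T) ∎
  where
    open ≤-Reasoning
    q = #stars r
    T = q ^ n
    Y = #ρ r (manyStars a m)
    Z = #ρ r (manyStars (suc a) m)
    eq₁ : ∀ q qa y z r → q * qa * (y + r * (z + z)) ≡ q * (qa * y) + (r * 2) * (q * qa * z)
    eq₁ = solve-∀
    eq₂ : ∀ q v va t → q * (va * t) + q * (v * va * t) ≡ (1 + v) * va * (q * t)
    eq₂ = solve-∀

starred : ∀ {n} → Vec Bool n → Restriction n → Vec Bool n
starred []      []            = []
starred (b ∷ m) (nothing ∷ ρ) = b ∷ starred m ρ
starred (b ∷ m) (just _ ∷ ρ)  = false ∷ starred m ρ

∥starred∥ : ∀ {n} a (m : Vec Bool n) ρ → manyStars a m ρ ≡ false → ∥ starred m ρ ∥ ≤ a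
∥starred∥ (suc a) []          []            h = z≤n
∥starred∥ (suc a) (true ∷ m)  (nothing ∷ ρ) h = s≤s (∥starred∥ a m ρ h)
∥starred∥ (suc a) (true ∷ m)  (just _ ∷ ρ)  h = ∥starred∥ (suc a) m ρ h
∥starred∥ (suc a) (false ∷ m) (nothing ∷ ρ) h = ∥starred∥ (suc a) m ρ h
∥starred∥ (suc a) (false ∷ m) (just _ ∷ ρ)  h = ∥starred∥ (suc a) m ρ h

-- The restriction supplies the other variables of `m`, so reading the free ones is enough to know
-- which assignment to `m` is in force.
starred-∩ : ∀ {n} (m : Vec Bool n) ρ {x y} → Agree (starred m ρ) x y → m ∩ (ρ ▹ x) ≡ m ∩ (ρ ▹ y)
starred-∩ []          []            []           = refl
starred-∩ (true ∷ m)  (nothing ∷ ρ) (keep a h)   = cong (a ∷_) (starred-∩ m ρ h)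
starred-∩ (false ∷ m) (nothing ∷ ρ) (skip _ _ h) = cong (false ∷_) (starred-∩ m ρ h)
starred-∩ (b ∷ m)     (just c ∷ ρ)  (skip _ _ h) = cong (b ∧ c ∷_) (starred-∩ m ρ h)

-- Disjunction over the assignments to m, extended by false; a disjunction over all of Vec Bool n would be too long
-- for the union bound.
anyOn : ∀ {n} → Vec Bool n → Fun n → Bool
anyOn []          P = P []
anyOn (true ∷ m)  P = anyOn m (P ∘ (true ∷_)) ∨ anyOn m (P ∘ (false ∷_))
anyOn (false ∷ m) P = anyOn m (P ∘ (false ∷_))

anyOn-false : ∀ {n} (m : Vec Bool n) P → anyOn m P ≡ false → ∀ z → P (m ∩ z) ≡ false
anyOn-false []          P h []          = h
anyOn-false (true ∷ m)  P h (true ∷ z)  = anyOn-false m _ (∨-conicalˡ _ _ h) z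
anyOn-false (true ∷ m)  P h (false ∷ z) = anyOn-false m _ (∨-conicalʳ _ _ h) z
anyOn-false (false ∷ m) P h (_ ∷ z)     = anyOn-false m _ h z

ind-∨ : ∀ a b → ind (a ∨ b) ≤ ind a + ind b
ind-∨ true  b = s≤s z≤n
ind-∨ false b = ≤-refl

#∨ : ∀ r {n} (A B : Restriction n → Bool) → #ρ r (λ ρ → A ρ ∨ B ρ) ≤ #ρ r A + #ρ r B
#∨ r A B = ≤-trans (∑-mono (stars r) (λ ρ → ind-∨ (A ρ) (B ρ))) (≤-reflexive (∑-+ (stars r) (ind ∘ A) (ind ∘ B)))

#anyOn : ∀ r k M {n n′} (m : Vec Bool n) (B : Vec Bool n → Restriction n′ → Bool) →
  (∀ β → k * #ρ r (B β) ≤ M) → k * #ρ r (λ ρ → anyOn m (λ β → B β ρ)) ≤ 2 ^ ∥ m ∥ * M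
#anyOn r k M []          B h = ≤-trans (h []) (≤-reflexive (sym (+-identityʳ M)))
#anyOn r k M (false ∷ m) B h = #anyOn r k M m (λ β → B (false ∷ β)) (λ β → h (false ∷ β))
#anyOn r k M (true ∷ m)  B h = begin
  k * #ρ r (λ ρ → anyOn m (λ β → B (true ∷ β) ρ) ∨ anyOn m (λ β → B (false ∷ β) ρ))
    ≤⟨ *-monoʳ-≤ k (#∨ r (λ ρ → anyOn m (λ β → B (true ∷ β) ρ)) (λ ρ → anyOn m (λ β → B (false ∷ β) ρ))) ⟩
  k * (#ρ r (λ ρ → anyOn m (λ β → B (true ∷ β) ρ)) + #ρ r (λ ρ → anyOn m (λ β → B (false ∷ β) ρ)))
    ≡⟨ *-distribˡ-+ k _ _ ⟩
  _ ≤⟨ +-mono-≤ (#anyOn r k M m (λ β → B (true ∷ β)) (λ β → h (true ∷ β)))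
                (#anyOn r k M m (λ β → B (false ∷ β)) (λ β → h (false ∷ β))) ⟩
  2 ^ ∥ m ∥ * M + 2 ^ ∥ m ∥ * M
    ≡⟨ eq (2 ^ ∥ m ∥) M ⟩
  2 * 2 ^ ∥ m ∥ * M ∎
  where
    open ≤-Reasoning
    eq : ∀ a b → a * b + a * b ≡ 2 * a * b
    eq = solve-∀

-- Exponentials

^-distribʳ-* : ∀ k m n → (m * n) ^ k ≡ m ^ k * n ^ k
^-distribʳ-* zero    m n = refl
^-distribʳ-* (suc k) m n = trans (cong (m * n *_) (^-distribʳ-* k m n)) (eq m n (m ^ k) (n ^ k))
  where
    eq : ∀ a b c d → a * b * (c * d) ≡ a * c * (b * d)
    eq = solve-∀

bernoulli : ∀ e k → e ^ suc k + suc k * e ^ k ≤ suc e ^ suc k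
bernoulli e zero    = ≤-reflexive (eq e)
  where
    eq : ∀ e → e * 1 + 1 * 1 ≡ (1 + e) * 1
    eq = solve-∀
bernoulli e (suc k) = begin
  e * (e * e ^ k) + (2 + k) * (e * e ^ k)
    ≡⟨ eq e k (e ^ k) ⟩
  e * (e * e ^ k + suc k * e ^ k) + e * e ^ k
    ≤⟨ +-mono-≤ (*-monoʳ-≤ e (bernoulli e k)) (≤-trans (m≤m+n (e * e ^ k) (suc k * e ^ k)) (bernoulli e k)) ⟩
  e * suc e ^ suc k + suc e ^ suc k
    ≡⟨ +-comm (e * suc e ^ suc k) (suc e ^ suc k) ⟩
  suc e * suc e ^ suc k ∎
  where
    open ≤-Reasoning
    eq : ∀ e k x → e * (e * x) + (2 + k) * (e * x) ≡ e * (e * x + (1 + k) * x) + e * x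
    eq = solve-∀

-- With B = e + 1 this is (1 - 1/B)^B ≤ 1/2: B independent events of probability 1/B all fail with
-- probability at most 1/2.
2*e^≤ : ∀ e → 2 * e ^ suc e ≤ suc e ^ suc e
2*e^≤ e = begin
  2 * (e * e ^ e)               ≤⟨ m≤m+n _ (e ^ e) ⟩
  2 * (e * e ^ e) + e ^ e       ≡⟨ eq e (e ^ e) ⟩
  e ^ suc e + suc e * e ^ e     ≤⟨ bernoulli e e ⟩
  suc e ^ suc e                 ∎
  where
    open ≤-Reasoning
    eq : ∀ e x → 2 * (e * x) + x ≡ e * x + (1 + e) * x
    eq = solve-∀

n<2^n : ∀ n → n < 2 ^ n
n<2^n zero    = s≤s z≤n
n<2^n (suc n) = ≤-trans (+-mono-≤ (≤-trans (s≤s z≤n) (n<2^n n)) (n<2^n n)) (≤-reflexive (eq (2 ^ n)))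
  where
    eq : ∀ a → a + a ≡ 2 * a
    eq = solve-∀

2n≤2^n : ∀ n → 2 * n ≤ 2 ^ n
2n≤2^n zero    = z≤n
2n≤2^n (suc n) = *-monoʳ-≤ 2 (n<2^n n)

linear≤2^ : ∀ c h → 2 * c ≤ h → c * h ≤ 2 ^ h
linear≤2^ c h le with m≤n⇒∃[o]m+o≡n le
... | o , refl = go o
  where
    open ≤-Reasoning
    go : ∀ o → c * (2 * c + o) ≤ 2 ^ (2 * c + o)
    go zero = begin
      c * (2 * c + 0)  ≡⟨ cong (c *_) (+-identityʳ (2 * c)) ⟩
      c * (2 * c)      ≤⟨ *-mono-≤ (<⇒≤ (n<2^n c)) (2n≤2^n c) ⟩
      2 ^ c * 2 ^ c    ≡⟨ sym (^-distribˡ-+-* 2 c c) ⟩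
      2 ^ (c + c)      ≡⟨ cong (2 ^_) (eq c) ⟩
      2 ^ (2 * c + 0)  ∎
      where
        eq : ∀ c → c + c ≡ 2 * c + 0
        eq = solve-∀
    go (suc o) = begin
      c * (2 * c + suc o)                    ≡⟨ eq₁ c o ⟩
      c * (2 * c + o) + c                    ≤⟨ +-mono-≤ (go o) (≤-trans (<⇒≤ (n<2^n c)) (^-monoʳ-≤ 2 (≤-trans (m≤m+n c (c + 0)) (m≤m+n (2 * c) o)))) ⟩
      2 ^ (2 * c + o) + 2 ^ (2 * c + o)      ≡⟨ eq₂ (2 ^ (2 * c + o)) ⟩
      2 ^ suc (2 * c + o)                    ≡⟨ cong (2 ^_) (sym (+-suc (2 * c) o)) ⟩
      2 ^ (2 * c + suc o)                    ∎
      where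
        eq₁ : ∀ c o → c * (2 * c + (1 + o)) ≡ c * (2 * c + o) + c
        eq₁ = solve-∀
        eq₂ : ∀ a → a + a ≡ 2 * a
        eq₂ = solve-∀

-- The switching lemma

-- A certificate is attached to a proof that `f` is true at x, so a Boolean test about certificates
-- must have access to that proof.
given : (b : Bool) → (b ≡ true → Bool) → Bool
given true  k = k refl
given false k = false

given-true : ∀ b k → given b k ≡ true → Σ (b ≡ true) λ p → k p ≡ true
given-true true k h = refl , h

given-false : ∀ b k → given b k ≡ false → ∀ p → k p ≡ false
given-false true k h refl = h

not-false : ∀ b → not b ≡ false → b ≡ true
not-false true h = refl

not-true : ∀ b → not b ≡ true → b ≡ false
not-true false h = refl

-- What i pairwise disjoint certificates provide: V is their union and `misses ρ` says that ρ satisfies none of them.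
record Disjoint {n} (r : ℕ) (f : Fun n) (b i : ℕ) : Set where
  field
    V       : Vec Bool n
    ∥V∥≤    : ∥ V ∥ ≤ i * b
    misses  : Restriction n → Bool
    depends : ∀ {ρ ρ′} → Agree V ρ ρ′ → misses ρ ≡ misses ρ′
    rare    : #ρ r misses * (3 ^ b) ^ i ≤ pred (3 ^ b) ^ i * #stars r ^ n
    hit     : ∀ ρ → misses ρ ≡ false → ∀ x → (f ∣ ρ) x ≡ true

∥none∥ : ∀ n → ∥ replicate n false ∥ ≡ 0
∥none∥ zero    = refl
∥none∥ (suc n) = ∥none∥ n

-- Only the certificates selected by `c` have to be met, which is what `certified-override` asks
-- for.
Hitting : ∀ {n b} {f : Fun n} → Certified true f b → ℕ → Set
Hitting {n} {b} {f} c i = Σ (Vec Bool n) λ V → ∥ V ∥ ≤ i * b × (∀ x p → meets (proj₁ (c x p)) V ≡ true)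

-- If some selected certificate avoids V, it joins the family. Its variables are fresh, so it is
-- satisfied with probability at least 3^-b even when all earlier ones are missed, and `misses`
-- shrinks by a factor 1 - 3^-b. If none avoids V, then V is a hitting set.
greedy : ∀ r → 1 ≤ r → ∀ {n b} {f : Fun n} (c : Certified true f b) i → Disjoint r f b i ⊎ Hitting c i
greedy r 1≤r {n} {b} {f} c zero = inj₁ record
  { V       = replicate n false
  ; ∥V∥≤    = ≤-reflexive (∥none∥ n)
  ; misses  = λ _ → true
  ; depends = λ _ → refl
  ; rare    = ≤-reflexive (trans (*-identityʳ _) (∑-const (stars r) n 1))
  ; hit     = λ ρ ()
  }
greedy r 1≤r {n} {b} {f} c (suc i) with greedy r 1≤r c i
... | inj₂ (V , ∥V∥≤ , h) = inj₂ (V , ≤-trans ∥V∥≤ (m≤n+m (i * b) b) , h)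
... | inj₁ D with search (λ x → given (f x) (λ p → not (meets (proj₁ (c x p)) (Disjoint.V D))))
...   | inj₂ none = inj₂ (Disjoint.V D , ≤-trans (Disjoint.∥V∥≤ D) (m≤n+m (i * b) b) ,
          λ x p → not-false _ (given-false (f x) _ (none x) p))
...   | inj₁ (x , q) with given-true (f x) _ q
...     | p , disj = inj₁ record
  { V       = m ∪ V
  ; ∥V∥≤    = ≤-trans (∥∪∥≤ m V) (+-mono-≤ ∥m∥≤ ∥V∥≤)
  ; misses  = misses′
  ; depends = λ a → cong₂ (λ u v → u ∧ not v) (depends (agree-∪ʳ m V a)) (forced-depends m x (agree-∪ˡ m V a))
  ; rare    = rare′
  ; hit     = hit′
  }
  where
    open Disjoint D
    m = proj₁ (c x p)
    ∥m∥≤ = proj₁ (proj₂ (c x p))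
    misses′ : Restriction n → Bool
    misses′ ρ = misses ρ ∧ not (forced m x ρ)
    hit′ : ∀ ρ → misses′ ρ ≡ false → ∀ y → (f ∣ ρ) y ≡ true
    hit′ ρ h y with misses ρ in eq
    ... | false = hit ρ eq y
    ... | true  = proj₂ (proj₂ (c x p)) (ρ ▹ y) (forced-agree m x ρ (not-false _ h) y)
    E = pred (3 ^ b)
    both = ∑ (stars r) (λ ρ → ind (forced m x ρ) * ind (misses ρ))
    split : #ρ r misses′ + both ≡ #ρ r misses
    split = trans (sym (∑-+ (stars r) (ind ∘ misses′) (λ ρ → ind (forced m x ρ) * ind (misses ρ))))
                  (∑-cong (stars r) (λ ρ → cases (misses ρ) (forced m x ρ)))
      where
        cases : ∀ u v → ind (u ∧ not v) + ind v * ind u ≡ ind u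
        cases true  true  = refl
        cases true  false = refl
        cases false true  = refl
        cases false false = refl
    often : #ρ r misses ≤ 3 ^ b * both
    often = ≤-trans
      (forced-indep r 1≤r m x V (ind ∘ misses) (not-true _ disj) (λ a → cong ind (depends a)))
      (*-monoˡ-≤ both (^-monoʳ-≤ 3 ∥m∥≤))
    -- With 3^b = 1 + E, adding `3 ^ b * both` to both sides avoids subtracting the restrictions
    -- that satisfy the new certificate.
    fewer : 3 ^ b * #ρ r misses′ ≤ E * #ρ r misses
    fewer = +-cancelʳ-≤ (3 ^ b * both) _ _ (begin
      3 ^ b * #ρ r misses′ + 3 ^ b * both  ≡⟨ sym (*-distribˡ-+ (3 ^ b) (#ρ r misses′) both) ⟩
      3 ^ b * (#ρ r misses′ + both)        ≡⟨ cong₂ _*_ (sym (suc-pred (3 ^ b) {{m^n≢0 3 b}})) split ⟩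
      #ρ r misses + E * #ρ r misses        ≡⟨ +-comm (#ρ r misses) _ ⟩
      E * #ρ r misses + #ρ r misses        ≤⟨ +-monoʳ-≤ (E * #ρ r misses) often ⟩
      E * #ρ r misses + 3 ^ b * both       ∎)
      where open ≤-Reasoning
    rare′ : #ρ r misses′ * (3 ^ b) ^ suc i ≤ E ^ suc i * #stars r ^ n
    rare′ = begin
      #ρ r misses′ * (3 ^ b * (3 ^ b) ^ i)    ≡⟨ eq₁ (#ρ r misses′) (3 ^ b) ((3 ^ b) ^ i) ⟩
      3 ^ b * #ρ r misses′ * (3 ^ b) ^ i      ≤⟨ *-monoˡ-≤ ((3 ^ b) ^ i) fewer ⟩
      E * #ρ r misses * (3 ^ b) ^ i           ≡⟨ *-assoc E _ _ ⟩
      E * (#ρ r misses * (3 ^ b) ^ i)         ≤⟨ *-monoʳ-≤ E rare ⟩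
      E * (E ^ i * #stars r ^ n)              ≡⟨ sym (*-assoc E _ _) ⟩
      E * E ^ i * #stars r ^ n                ∎
      where
        open ≤-Reasoning
        eq₁ : ∀ a b c → a * (b * c) ≡ b * a * c
        eq₁ = solve-∀

-- Width b becomes width t in the opposite normal form, with t independent of n and f. The choice r
-- = 4^h makes a variable free with probability below 4^-h; failure has probability at most 2^(-κh).
Switching : ℕ → ℕ → ℕ → ℕ → Set
Switching b κ t h = ∀ {n} (f : Fun n) → Certified true f b → Σ (Restriction n → Bool) λ bad →
  2 ^ (κ * h) * #ρ (4 ^ h) bad ≤ #stars (4 ^ h) ^ n × (∀ ρ → bad ρ ≡ false → Certified false (f ∣ ρ) t)

-- The certificates split into k blocks of 3^b, and each block halves the probability of missing all
-- of them.
many-disjoint : ∀ r k {n b} {f : Fun n} (D : Disjoint r f b (3 ^ b * k)) →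
  2 ^ k * #ρ r (Disjoint.misses D) ≤ #stars r ^ n
many-disjoint r k {n} {b} D = *-cancelˡ-≤ (B ^ R) {{m^n≢0 B R {{m^n≢0 3 b}}}} (begin
  B ^ R * (2 ^ k * a)               ≡⟨ eq (B ^ R) (2 ^ k) a ⟩
  2 ^ k * (a * B ^ R)               ≤⟨ *-monoʳ-≤ (2 ^ k) rare ⟩
  2 ^ k * (E ^ R * T)               ≡⟨ sym (*-assoc (2 ^ k) (E ^ R) T) ⟩
  2 ^ k * E ^ R * T                 ≡⟨ cong (λ z → 2 ^ k * z * T) (sym (^-*-assoc E B k)) ⟩
  2 ^ k * (E ^ B) ^ k * T           ≡⟨ cong (_* T) (sym (^-distribʳ-* k 2 (E ^ B))) ⟩
  (2 * E ^ B) ^ k * T               ≤⟨ *-monoˡ-≤ T (^-monoˡ-≤ k base) ⟩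
  (B ^ B) ^ k * T                   ≡⟨ cong (_* T) (^-*-assoc B B k) ⟩
  B ^ R * T                         ∎)
  where
    open ≤-Reasoning
    open Disjoint D
    B = 3 ^ b
    E = pred B
    R = B * k
    a = #ρ r misses
    T = #stars r ^ n
    base : 2 * E ^ B ≤ B ^ B
    base = subst (λ z → 2 * E ^ z ≤ z ^ z) (suc-pred B {{m^n≢0 3 b}}) (2*e^≤ E)
    eq : ∀ x y z → x * (y * z) ≡ y * (z * x)
    eq = solve-∀

-- Either there are so many disjoint certificates that ρ satisfies one of them, or a small set V meets them all: then few
-- variables of V remain free and every assignment to V leaves a function of width b.
switching : ∀ b κ → Σ ℕ λ t → Σ ℕ λ h₀ → ∀ h → h₀ ≤ h → Switching b κ t h
-- Width 0 makes `f` constant: no restriction is bad and nothing has to be read.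
switching zero κ = 0 , 0 , λ h _ {n} f c → (λ _ → false) ,
  ≤-trans (≤-reflexive (trans (cong (2 ^ (κ * h) *_) (∑-const (stars (4 ^ h)) n 0)) (*-zeroʳ (2 ^ (κ * h))))) z≤n ,
  λ ρ _ x p → replicate n false , ≤-reflexive (∥none∥ n) , λ y _ → constant f c p
  where
    empty-agree : ∀ {n} (m x y : Vec Bool n) → ∥ m ∥ ≤ 0 → Agree m x y
    empty-agree []          []      []      _ = []
    empty-agree (false ∷ m) (a ∷ x) (b ∷ y) h = skip a b (empty-agree m x y h)
    constant : ∀ {n} (f : Fun n) → Certified true f 0 → ∀ {x y} → f x ≡ false → f y ≡ false
    constant f c {x} {y} p with f y in q
    ... | false = refl
    ... | true with c y q
    ...   | m , m≤ , h = trans (sym (h x (empty-agree m y x m≤))) p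
-- The hitting set will have at most c h variables, so the union bound over its assignments costs
-- 2^(c h), paid for by the summand c = `suc b * (3 ^ suc b * κ)`. The unit beyond κ absorbs the
-- factor 2 from adding two kinds of failure.
switching (suc b) κ with switching b (suc κ + suc b * (3 ^ suc b * κ))
-- At most `suc κ` free variables of the hitting set are read, then a certificate of size `t′`.
-- Having h ≥ 2c gives c h ≤ 2^h, and the extra 1 gives 2 ≤ 2^h.
... | t′ , h′ , IH = suc κ + t′ , h′ ⊔ suc (2 * c) , step
  where
    c = suc b * (3 ^ suc b * κ)
    step : ∀ h → h′ ⊔ suc (2 * c) ≤ h → Switching (suc b) κ (suc κ + t′) h
    step h le {n} f cert with greedy (4 ^ h) (m^n>0 4 h) cert (3 ^ suc b * (κ * h))
    ... | inj₁ D = Disjoint.misses D , many-disjoint (4 ^ h) (κ * h) D ,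
          λ ρ hit x p → contra (trans (sym (Disjoint.hit D ρ hit x)) p)
      where
        contra : ∀ {A : Set} → true ≡ false → A
        contra ()
    ... | inj₂ (V , ∥V∥≤ , meet) = bad , small , good
      where
        r = 4 ^ h
        T = #stars r ^ n
        g : Vec Bool n → Fun n
        g β y = f (override V β y)
        sub : ∀ β → _
        sub β = IH h (≤-trans (m≤m⊔n h′ (suc (2 * c))) le) (g β) (certified-override cert V β meet)
        many some bad : Restriction n → Bool
        many = manyStars (suc κ) V
        some ρ = anyOn V (λ β → proj₁ (sub β) ρ)
        bad ρ = many ρ ∨ some ρ
        1+2c≤h : suc (2 * c) ≤ h
        1+2c≤h = ≤-trans (m≤n⊔m h′ (suc (2 * c))) le
        V≤ch : ∥ V ∥ ≤ c * h
        V≤ch = ≤-trans ∥V∥≤ (≤-reflexive (eq (3 ^ suc b) κ h (suc b)))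
          where
            eq : ∀ x k h s → x * (k * h) * s ≡ s * (x * k) * h
            eq = solve-∀
        V≤2^h : ∥ V ∥ ≤ 2 ^ h
        V≤2^h = ≤-trans V≤ch (linear≤2^ c h (≤-trans (n≤1+n _) 1+2c≤h))
        open ≤-Reasoning
        K = 2 ^ (suc κ * h)
        K≡ : K ≡ (2 ^ h) ^ suc κ
        K≡ = trans (cong (2 ^_) (*-comm (suc κ) h)) (sym (^-*-assoc 2 h (suc κ)))
        r-square : 2 ^ h * 2 ^ h ≤ #stars r
        r-square = begin
          2 ^ h * 2 ^ h  ≡⟨ sym (^-distribʳ-* h 2 2) ⟩
          r              ≤⟨ m≤m*n r 2 ⟩
          r * 2          ≤⟨ n≤1+n (r * 2) ⟩
          #stars r       ∎
        -- The reason for r = 4^h: q is at least the square of 2^h while V has at most 2^h elements,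
        -- so each demanded free variable gains a factor 2^h.
        many-small : K * #ρ r many ≤ T
        many-small = *-cancelˡ-≤ K {{m^n≢0 2 (suc κ * h)}} (begin
          K * (K * #ρ r many)                    ≡⟨ sym (*-assoc K K _) ⟩
          K * K * #ρ r many                      ≡⟨ cong (_* #ρ r many) (trans (cong₂ _*_ K≡ K≡) (sym (^-distribʳ-* (suc κ) (2 ^ h) (2 ^ h)))) ⟩
          (2 ^ h * 2 ^ h) ^ suc κ * #ρ r many    ≤⟨ *-monoˡ-≤ (#ρ r many) (^-monoˡ-≤ (suc κ) r-square) ⟩
          #stars r ^ suc κ * #ρ r many           ≤⟨ #manyStars r (suc κ) V ⟩
          ∥ V ∥ ^ suc κ * T                      ≤⟨ *-monoˡ-≤ T (^-monoˡ-≤ (suc κ) V≤2^h) ⟩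
          (2 ^ h) ^ suc κ * T                    ≡⟨ cong (_* T) (sym K≡) ⟩
          K * T                                  ∎)
        some-small : K * #ρ r some ≤ T
        some-small = *-cancelˡ-≤ (2 ^ (c * h)) {{m^n≢0 2 (c * h)}} (begin
          2 ^ (c * h) * (K * #ρ r some)          ≡⟨ eq (2 ^ (c * h)) K (#ρ r some) ⟩
          K * 2 ^ (c * h) * #ρ r some            ≡⟨ cong (_* #ρ r some) (sym (^-distribˡ-+-* 2 (suc κ * h) (c * h))) ⟩
          2 ^ (suc κ * h + c * h) * #ρ r some    ≡⟨ cong (λ z → 2 ^ z * #ρ r some) (sym (*-distribʳ-+ h (suc κ) c)) ⟩
          2 ^ ((suc κ + c) * h) * #ρ r some      ≤⟨ #anyOn r (2 ^ ((suc κ + c) * h)) T V (λ β → proj₁ (sub β)) (λ β → proj₁ (proj₂ (sub β))) ⟩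
          2 ^ ∥ V ∥ * T                          ≤⟨ *-monoˡ-≤ T (^-monoʳ-≤ 2 V≤ch) ⟩
          2 ^ (c * h) * T                        ∎)
          where
            eq : ∀ x y z → x * (y * z) ≡ y * x * z
            eq = solve-∀
        small : 2 ^ (κ * h) * #ρ r bad ≤ T
        small = *-cancelˡ-≤ 2 (begin
          2 * (2 ^ (κ * h) * #ρ r bad)           ≡⟨ sym (*-assoc 2 (2 ^ (κ * h)) (#ρ r bad)) ⟩
          2 ^ 1 * 2 ^ (κ * h) * #ρ r bad         ≤⟨ *-monoˡ-≤ (#ρ r bad) (*-monoˡ-≤ (2 ^ (κ * h)) (^-monoʳ-≤ 2 (≤-trans (s≤s z≤n) 1+2c≤h))) ⟩
          2 ^ h * 2 ^ (κ * h) * #ρ r bad         ≡⟨ cong (_* #ρ r bad) (sym (^-distribˡ-+-* 2 h (κ * h))) ⟩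
          K * #ρ r bad                           ≤⟨ *-monoʳ-≤ K (#∨ r many some) ⟩
          K * (#ρ r many + #ρ r some)            ≡⟨ *-distribˡ-+ K _ _ ⟩
          K * #ρ r many + K * #ρ r some          ≤⟨ +-mono-≤ many-small some-small ⟩
          T + T                                  ≡⟨ cong (λ z → T + z) (sym (+-identityʳ T)) ⟩
          2 * T                                  ∎)
        good : ∀ ρ → bad ρ ≡ false → Certified false (f ∣ ρ) (suc κ + t′)
        good ρ h x p with ∨-conicalˡ (many ρ) (some ρ) h | ∨-conicalʳ (many ρ) (some ρ) h
        -- Take β to be the assignment that `ρ ▹ x` induces on V. Every y that agrees with x on the
        -- free part of V induces the same β, so `f ∣ ρ` coincides there with `g β ∣ ρ` and inherits
        -- its certificate.
        ... | few | fine with proj₂ (proj₂ (sub (V ∩ (ρ ▹ x)))) ρ (anyOn-false V _ fine (ρ ▹ x)) x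
                                (trans (cong f (override-∩ V (ρ ▹ x))) p)
        ...   | m , m≤ , forces = starred V ρ ∪ m ,
                ≤-trans (∥∪∥≤ (starred V ρ) m) (+-mono-≤ (∥starred∥ (suc κ) V ρ few) m≤) ,
                λ y a → trans
                  (cong f (trans (sym (override-∩ V (ρ ▹ y)))
                                 (cong (λ β → override V β (ρ ▹ y)) (sym (starred-∩ V ρ (agree-∪ˡ (starred V ρ) m a))))))
                  (forces y (agree-∪ʳ (starred V ρ) m a))

-- Circuits

certified-cong : ∀ {v n} {f g : Fun n} {b} → (∀ x → f x ≡ g x) → Certified v f b → Certified v g b
certified-cong f≗g c x p with c x (trans (f≗g x) p)
... | m , m≤ , h = m , m≤ , λ y a → trans (sym (f≗g y)) (h y a)

switch : ∀ v {b κ t h} → Switching b κ t h → ∀ {n} (f : Fun n) → Certified v f b → Σ (Restriction n → Bool) λ bad →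
  2 ^ (κ * h) * #ρ (4 ^ h) bad ≤ #stars (4 ^ h) ^ n × (∀ ρ → bad ρ ≡ false → Certified (not v) (f ∣ ρ) t)
switch true  S f c = S f c
switch false S f c with S (not ∘ f) (certified-not c)
... | bad , small , good = bad , small , λ ρ ok →
  certified-cong (λ x → not-involutive ((f ∣ ρ) x)) (certified-not (good ρ ok))

switch-all : ∀ v {b κ t h} → Switching b κ t h → ∀ {n} w (F : Fin w → Fun n) → (∀ j → Certified v (F j) b) →
  Σ (Restriction n → Bool) λ bad → 2 ^ (κ * h) * #ρ (4 ^ h) bad ≤ w * #stars (4 ^ h) ^ n ×
    (∀ ρ → bad ρ ≡ false → ∀ j → Certified (not v) (F j ∣ ρ) t)
switch-all v {κ = κ} {h = h} S {n} zero F c = (λ _ → false) ,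
  ≤-reflexive (trans (cong (2 ^ (κ * h) *_) (∑-const (stars (4 ^ h)) n 0)) (*-zeroʳ (2 ^ (κ * h)))) ,
  λ ρ _ ()
switch-all v {κ = κ} {h = h} S {n} (suc w) F c
  with switch v {κ = κ} {h = h} S (F zero) (c zero) | switch-all v {κ = κ} {h = h} S w (F ∘ suc) (c ∘ suc)
... | bad , small , good | bads , smalls , goods = (λ ρ → bad ρ ∨ bads ρ) ,
  ≤-trans (*-monoʳ-≤ (2 ^ (κ * h)) (#∨ (4 ^ h) bad bads))
    (≤-trans (≤-reflexive (*-distribˡ-+ (2 ^ (κ * h)) _ _)) (+-mono-≤ small smalls)) ,
  λ ρ ok → λ { zero    → good ρ (∨-conicalˡ (bad ρ) (bads ρ) ok)
             ; (suc j) → goods ρ (∨-conicalʳ (bad ρ) (bads ρ) ok) j }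

-- `H` stands for the rest of the circuit and is an arbitrary function: the restriction acts on its
-- inputs only. For a good ρ these have certificates for both values and `bound` applies. A bad ρ is
-- charged n 2^n, and `room` makes the total of these charges, after scaling by q, at most the
-- summand 1.
stage : ∀ v {b κ t h} → Switching b κ t h → ∀ {n} w (F : Fin w → Fun n) → (∀ j → Certified v (F j) b) →
  w * n * #stars (4 ^ h) ≤ 2 ^ (κ * h) →
  (H : (Fin w → Bool) → Bool) (B : ℕ) →
  (∀ (F′ : Fin w → Fun n) → (∀ j u → Certified u (F′ j) (b + t)) → N (λ x → H (λ j → F′ j x)) ≤ B * 2 ^ n) →
  N (λ x → H (λ j → F j x)) ≤ (#stars (4 ^ h) * B + 1) * 2 ^ n
stage v {b} {κ} {t} {h} S {n} w F c room H B bound with switch-all v {κ = κ} {h = h} S w F c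
... | bad , small , good = *-cancelˡ-≤ (q ^ n) {{m^n≢0 q n}} (begin
  q ^ n * N f                                        ≡⟨ sym (∑-N-restrict r f) ⟩
  q * ∑ (stars r) (λ ρ → N (f ∣ ρ))                  ≤⟨ *-monoʳ-≤ q (∑-mono (stars r) pointwise) ⟩
  q * ∑ (stars r) (λ ρ → X + Y * ind (bad ρ))        ≡⟨ cong (q *_) (trans (∑-+ (stars r) {n} (λ _ → X) (λ ρ → Y * ind (bad ρ)))
                                                          (cong₂ _+_ (∑-const (stars r) n X) (∑-* (stars r) Y (ind ∘ bad)))) ⟩
  q * (X * q ^ n + Y * #ρ r bad)                     ≡⟨ eq₁ q B (2 ^ n) (q ^ n) n (#ρ r bad) ⟩
  q ^ n * (q * B * 2 ^ n) + n * q * #ρ r bad * 2 ^ n ≤⟨ +-monoʳ-≤ (q ^ n * (q * B * 2 ^ n)) (*-monoˡ-≤ (2 ^ n) rare) ⟩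
  q ^ n * (q * B * 2 ^ n) + q ^ n * 2 ^ n            ≡⟨ eq₂ (q ^ n) (q * B) (2 ^ n) ⟩
  q ^ n * ((q * B + 1) * 2 ^ n)                      ∎)
  where
    open ≤-Reasoning
    r = 4 ^ h
    q = #stars r
    f : Fun n
    f x = H (λ j → F j x)
    X = B * 2 ^ n
    Y = n * 2 ^ n
    both : ∀ ρ → bad ρ ≡ false → ∀ u j → Certified u (F j ∣ ρ) (b + t)
    both ρ ok = by v refl
      where
        keeps : ∀ j → Certified v (F j ∣ ρ) (b + t)
        keeps j = certified-mono (m≤m+n b t) (certified-∣ ρ (c j))
        gains : ∀ j → Certified (not v) (F j ∣ ρ) (b + t)
        gains j = certified-mono (m≤n+m t b) (good ρ ok j)
        by : ∀ v′ → v′ ≡ v → ∀ u j → Certified u (F j ∣ ρ) (b + t)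
        by true  refl true  = keeps
        by true  refl false = gains
        by false refl true  = gains
        by false refl false = keeps
    pointwise : ∀ ρ → N (f ∣ ρ) ≤ X + Y * ind (bad ρ)
    pointwise ρ with bad ρ in eq
    ... | true  = ≤-trans (N-≤ (f ∣ ρ)) (≤-trans (≤-reflexive (sym (*-identityʳ Y))) (m≤n+m (Y * 1) X))
    ... | false = ≤-trans (bound (λ j → F j ∣ ρ) (λ j u → both ρ eq u j)) (m≤m+n X (Y * 0))
    rare : n * q * #ρ r bad ≤ q ^ n
    rare = *-cancelˡ-≤ (2 ^ (κ * h)) {{m^n≢0 2 (κ * h)}} (begin
      2 ^ (κ * h) * (n * q * #ρ r bad)  ≡⟨ eq₃ (2 ^ (κ * h)) (n * q) (#ρ r bad) ⟩
      n * q * (2 ^ (κ * h) * #ρ r bad)  ≤⟨ *-monoʳ-≤ (n * q) small ⟩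
      n * q * (w * q ^ n)               ≡⟨ eq₄ n q w (q ^ n) ⟩
      w * n * q * q ^ n                 ≤⟨ *-monoˡ-≤ (q ^ n) room ⟩
      2 ^ (κ * h) * q ^ n               ∎)
      where
        eq₃ : ∀ a b c → a * (b * c) ≡ b * (a * c)
        eq₃ = solve-∀
        eq₄ : ∀ n q w z → n * q * (w * z) ≡ w * n * q * z
        eq₄ = solve-∀
    eq₁ : ∀ q B P Q n z → q * (B * P * Q + n * P * z) ≡ Q * (q * B * P) + n * q * z * P
    eq₁ = solve-∀
    eq₂ : ∀ Q b P → Q * (b * P) + Q * P ≡ Q * ((b + 1) * P)
    eq₂ = solve-∀

single : ∀ {n} → Fin n → Vec Bool n
single {suc n} zero    = true ∷ replicate n false
single {suc n} (suc i) = false ∷ single i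

∥single∥ : ∀ {n} (i : Fin n) → ∥ single i ∥ ≡ 1
∥single∥ {suc n} zero    = cong suc (∥none∥ n)
∥single∥ {suc n} (suc i) = ∥single∥ i

agree-single : ∀ {n} (i : Fin n) {x y : Vec Bool n} → Agree (single i) x y → lookup x i ≡ lookup y i
agree-single zero    (keep a h)   = refl
agree-single (suc i) (skip a b h) = agree-single i h

certified-literal : ∀ {n} v (l : Fin n × Bool) → Certified v (λ x → literal (lookup x) l) 1
certified-literal v (i , true)  x p = single i , ≤-reflexive (∥single∥ i) , λ y a → trans (sym (agree-single i a)) p
certified-literal v (i , false) x p = single i , ≤-reflexive (∥single∥ i) , λ y a → trans (cong not (sym (agree-single i a))) p

-- Certificate size after d rounds, starting from literals. Adding the old size to the new one
-- bounds both the polarity that is kept and the one that is gained.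
width : ℕ → ℕ → ℕ
width κ zero    = 1
width κ (suc d) = width κ d + proj₁ (switching (width κ d) κ)

threshold : ℕ → ℕ → ℕ
threshold κ zero    = 0
threshold κ (suc d) = threshold κ d ⊔ proj₁ (proj₂ (switching (width κ d) κ))

loss : ℕ → ℕ → ℕ → ℕ
loss q zero    B = B
loss q (suc d) B = loss q d (q * B + 1)

loss-≤ : ∀ q d B → 1 ≤ q → loss q d B ≤ q ^ d * (B + d)
loss-≤ q zero    B 1≤q = ≤-reflexive (eq B)
  where
    eq : ∀ b → b ≡ 1 * (b + 0)
    eq = solve-∀
loss-≤ q (suc d) B 1≤q = begin
  loss q d (q * B + 1)             ≤⟨ loss-≤ q d (q * B + 1) 1≤q ⟩
  q ^ d * (q * B + 1 + d)          ≡⟨ cong (q ^ d *_) (+-assoc (q * B) 1 d) ⟩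
  q ^ d * (q * B + suc d)          ≡⟨ cong (λ z → q ^ d * (q * B + z)) (sym (*-identityˡ (suc d))) ⟩
  q ^ d * (q * B + 1 * suc d)      ≤⟨ *-monoʳ-≤ (q ^ d) (+-monoʳ-≤ (q * B) (*-monoˡ-≤ (suc d) 1≤q)) ⟩
  q ^ d * (q * B + q * suc d)      ≡⟨ eq q (q ^ d) B d ⟩
  q * q ^ d * (B + suc d)          ∎
  where
    open ≤-Reasoning
    eq : ∀ q x b d → x * (q * b + q * (1 + d)) ≡ q * x * (b + (1 + d))
    eq = solve-∀

-- Each level costs one restriction, which turns the gates of that level into functions with small certificates;
-- H is the part of the circuit above L.
N-levels : ∀ κ h {n d w} (L : Levels n d w) s → size L ≤ s → s * n * #stars (4 ^ h) ≤ 2 ^ (κ * h) → threshold κ d ≤ h →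
  ∀ t (H : (Fin w → Bool) → Bool) B →
  (∀ (F : Fin w → Fun n) → (∀ j u → Certified u (F j) (width κ d)) → N (λ x → H (λ j → F j x)) ≤ B * 2 ^ n) →
  N (λ x → H (evalL L t (lookup x))) ≤ loss (#stars (4 ^ h)) d B * 2 ^ n
N-levels κ h {n} (first w gs) s size≤ room h≥ t H B bound =
  stage (not t) {κ = κ} {h = h} (proj₂ (proj₂ (switching 1 κ)) h h≥) w
    (λ j x → gate t (List.map (literal (lookup x)) (lookup gs j)))
    (λ j → certified-gate t (λ l x → literal (lookup x) l) (certified-literal (not t)) (lookup gs j))
    (≤-trans (*-monoˡ-≤ _ (*-monoˡ-≤ n size≤)) room) H B bound
N-levels κ h {n} (next {d} {w} L w′ gs) s size≤ room h≥ t H B bound =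
  -- The top gates are absorbed into `H`, and their own `stage` becomes the bound demanded of the
  -- levels below. Thus the bottom level is restricted first although the recursion starts at the
  -- top.
  N-levels κ h L s (≤-trans (m≤m+n (size L) w′) size≤) room (≤-trans (m≤m⊔n (threshold κ d) _) h≥) (not t)
    (λ u → H (λ j → gate t (List.map u (lookup gs j)))) (#stars (4 ^ h) * B + 1)
    (λ F c → stage (not t) {κ = κ} {h = h}
      (proj₂ (proj₂ (switching (width κ d) κ)) h (≤-trans (m≤n⊔m (threshold κ d) _) h≥)) w′
      (λ j x → gate t (List.map (λ i → F i x) (lookup gs j)))
      (λ j → certified-gate t F (λ i → c i (not t)) (lookup gs j))
      (≤-trans (*-monoˡ-≤ _ (*-monoˡ-≤ n (≤-trans (m≤n+m w′ (size L)) size≤))) room) H B bound)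

-- An integral substitute for 2^h = n^(1/e), exact up to a factor 2. The fuel suffices because h <
-- 2^h stops the search once h has reached n.
between-powers : ∀ e → 1 ≤ e → ∀ n h₀ → 2 ^ (e * h₀) ≤ n → Σ ℕ λ h → h₀ ≤ h × 2 ^ (e * h) ≤ n × n < 2 ^ (e * suc h)
between-powers e 1≤e n h₀ le = go n h₀ ≤-refl le (m≤n+m n h₀)
  where
    open ≤-Reasoning
    go : ∀ fuel h → h₀ ≤ h → 2 ^ (e * h) ≤ n → n ≤ h + fuel → Σ ℕ λ h → h₀ ≤ h × 2 ^ (e * h) ≤ n × n < 2 ^ (e * suc h)
    go fuel h h₀≤h low up with n <? 2 ^ (e * suc h)
    ... | yes lt = h , h₀≤h , low , lt
    go (suc fuel) h h₀≤h low up | no nlt =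
      go fuel (suc h) (m≤n⇒m≤1+n h₀≤h) (≮⇒≥ nlt) (≤-trans up (≤-reflexive (+-suc h fuel)))
    go zero h h₀≤h low up | no nlt = ⊥-elim (nlt (begin-strict
      n                 ≤⟨ up ⟩
      h + 0             ≡⟨ +-identityʳ h ⟩
      h                 <⟨ n<2^n h ⟩
      2 ^ h             ≤⟨ ^-monoʳ-≤ 2 (≤-trans (n≤1+n h) (≤-trans (≤-reflexive (sym (*-identityˡ (suc h)))) (*-monoˡ-≤ (suc h) 1≤e))) ⟩
      2 ^ (e * suc h)   ∎))

#stars-≤ : ∀ h → 1 ≤ h → #stars (4 ^ h) ≤ 2 ^ (4 * h)
#stars-≤ h 1≤h = begin
  1 + 4 ^ h * 2           ≤⟨ +-monoˡ-≤ (4 ^ h * 2) (m^n>0 4 h) ⟩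
  4 ^ h + 4 ^ h * 2       ≤⟨ m≤n+m _ (4 ^ h) ⟩
  4 ^ h + (4 ^ h + 4 ^ h * 2) ≡⟨ eq (4 ^ h) ⟩
  4 ^ 1 * 4 ^ h           ≤⟨ *-monoˡ-≤ (4 ^ h) (^-monoʳ-≤ 4 1≤h) ⟩
  4 ^ h * 4 ^ h           ≡⟨ sym (^-distribʳ-* h 4 4) ⟩
  (2 ^ 4) ^ h             ≡⟨ ^-*-assoc 2 4 h ⟩
  2 ^ (4 * h)             ∎
  where
    open ≤-Reasoning
    eq : ∀ x → x + (x + x * 2) ≡ 4 ^ 1 * x
    eq = solve-∀

N-circuit : ∀ c d → Σ ℕ λ n₀ → 1 ≤ n₀ × (∀ n → n₀ ≤ n → (C : Levels n d 1) (t : Bool) → size C ≤ c * n ^ c →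
  2 * N (λ x → evalL C t (lookup x) zero) < n * 2 ^ n)
N-circuit c d = 2 ^ (e * h₀) , m^n>0 2 (e * h₀) , main
  where
    open ≤-Reasoning
    -- q^d ≤ 2^(4dh), and the one extra factor 2^h covers the constant 2(b + d).
    e = suc (4 * d)
    -- The four summands pay for c, n^c, n and q in this order, using n ≤ 2^(2eh) and q ≤ 2^(4h).
    κ = c + 2 * e * c + 2 * e + 4
    b = width κ d
    h₀ = suc (2 * (b + d)) ⊔ threshold κ d
    main : ∀ n → 2 ^ (e * h₀) ≤ n → (C : Levels n d 1) (t : Bool) → size C ≤ c * n ^ c →
      2 * N (λ x → evalL C t (lookup x) zero) < n * 2 ^ n
    main n n₀≤n C t size≤ with between-powers e (s≤s z≤n) n h₀ n₀≤n
    ... | h , h₀≤h , low , up = begin-strict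
      2 * N (λ x → evalL C t (lookup x) zero)
        ≤⟨ *-monoʳ-≤ 2 (N-levels κ h C (c * n ^ c) size≤ room (≤-trans (m≤n⊔m _ (threshold κ d)) h₀≤h) t (λ u → u zero) b
             (λ F cert → N-≤-cert (F zero) b (cert zero))) ⟩
      2 * (loss q d b * 2 ^ n)
        ≤⟨ *-monoʳ-≤ 2 (*-monoˡ-≤ (2 ^ n) (loss-≤ q d b (s≤s z≤n))) ⟩
      2 * (q ^ d * (b + d) * 2 ^ n)
        ≡⟨ eq₁ (q ^ d) (b + d) (2 ^ n) ⟩
      2 * (b + d) * q ^ d * 2 ^ n
        <⟨ *-monoˡ-< (2 ^ n) {{m^n≢0 2 n}} small ⟩
      n * 2 ^ n ∎
      where
        q = #stars (4 ^ h)
        2bd<h : suc (2 * (b + d)) ≤ h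
        2bd<h = ≤-trans (m≤m⊔n _ (threshold κ d)) h₀≤h
        1≤h : 1 ≤ h
        1≤h = ≤-trans (s≤s z≤n) 2bd<h
        eq₁ : ∀ x y z → 2 * (x * y * z) ≡ 2 * y * x * z
        eq₁ = solve-∀
        small : 2 * (b + d) * q ^ d < n
        small = begin-strict
          2 * (b + d) * q ^ d            <⟨ *-monoˡ-< (q ^ d) {{m^n≢0 q d}} (<-≤-trans 2bd<h (<⇒≤ (n<2^n h))) ⟩
          2 ^ h * q ^ d                  ≤⟨ *-monoʳ-≤ (2 ^ h) (^-monoˡ-≤ d (#stars-≤ h 1≤h)) ⟩
          2 ^ h * (2 ^ (4 * h)) ^ d      ≡⟨ cong (2 ^ h *_) (^-*-assoc 2 (4 * h) d) ⟩
          2 ^ h * 2 ^ (4 * h * d)        ≡⟨ sym (^-distribˡ-+-* 2 h (4 * h * d)) ⟩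
          2 ^ (h + 4 * h * d)            ≡⟨ cong (2 ^_) (eq₂ h d) ⟩
          2 ^ (e * h)                    ≤⟨ low ⟩
          n                              ∎
          where
            eq₂ : ∀ h d → h + 4 * h * d ≡ (1 + 4 * d) * h
            eq₂ = solve-∀
        n≤ : n ≤ 2 ^ (2 * e * h)
        n≤ = ≤-trans (<⇒≤ up) (^-monoʳ-≤ 2 (begin
          e * suc h      ≡⟨ *-suc e h ⟩
          e + e * h      ≡⟨ cong (_+ e * h) (sym (*-identityʳ e)) ⟩
          e * 1 + e * h  ≤⟨ +-monoˡ-≤ (e * h) (*-monoʳ-≤ e 1≤h) ⟩
          e * h + e * h  ≡⟨ eq₃ e h ⟩
          2 * e * h      ∎))
          where
            eq₃ : ∀ e h → e * h + e * h ≡ 2 * e * h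
            eq₃ = solve-∀
        c≤ : c ≤ 2 ^ (c * h)
        c≤ = ≤-trans (<⇒≤ (n<2^n c)) (^-monoʳ-≤ 2 (≤-trans (≤-reflexive (sym (*-identityʳ c))) (*-monoʳ-≤ c 1≤h)))
        room : c * n ^ c * n * q ≤ 2 ^ (κ * h)
        room = begin
          c * n ^ c * n * q
            ≤⟨ *-mono-≤ (*-mono-≤ (*-mono-≤ c≤ (≤-trans (^-monoˡ-≤ c n≤) (≤-reflexive (^-*-assoc 2 (2 * e * h) c)))) n≤) (#stars-≤ h 1≤h) ⟩
          2 ^ (c * h) * 2 ^ (2 * e * h * c) * 2 ^ (2 * e * h) * 2 ^ (4 * h)
            ≡⟨ cong (λ z → z * 2 ^ (2 * e * h) * 2 ^ (4 * h)) (sym (^-distribˡ-+-* 2 (c * h) (2 * e * h * c))) ⟩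
          2 ^ (c * h + 2 * e * h * c) * 2 ^ (2 * e * h) * 2 ^ (4 * h)
            ≡⟨ cong (_* 2 ^ (4 * h)) (sym (^-distribˡ-+-* 2 (c * h + 2 * e * h * c) (2 * e * h))) ⟩
          2 ^ (c * h + 2 * e * h * c + 2 * e * h) * 2 ^ (4 * h)
            ≡⟨ sym (^-distribˡ-+-* 2 (c * h + 2 * e * h * c + 2 * e * h) (4 * h)) ⟩
          2 ^ (c * h + 2 * e * h * c + 2 * e * h + 4 * h)
            ≡⟨ cong (2 ^_) (eq₄ c e h) ⟩
          2 ^ (κ * h) ∎
          where
            eq₄ : ∀ c e h → c * h + 2 * e * h * c + 2 * e * h + 4 * h ≡ (c + 2 * e * c + 2 * e + 4) * h
            eq₄ = solve-∀

-- Inputs as vectors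

Ext : ∀ {n} {A : Set} → (Input n → A) → Set
Ext f = ∀ {x y} → (∀ i → x i ≡ y i) → f x ≡ f y

vec : ∀ {n} → BoolFun n → Fun n
vec f v = f (lookup v)

lookup-∷ : ∀ {n} b (v : Vec Bool n) i → (b ∷ᶠ lookup v) i ≡ lookup (b ∷ v) i
lookup-∷ b v zero    = refl
lookup-∷ b v (suc i) = refl

∷ᶠ-cong : ∀ {n} b {x y : Input n} → (∀ i → x i ≡ y i) → ∀ i → (b ∷ᶠ x) i ≡ (b ∷ᶠ y) i
∷ᶠ-cong b h zero    = refl
∷ᶠ-cong b h (suc i) = h i

length-filter-∷ : ∀ {A : Set} (p : A → Bool) x xs →
  List.length (List.filterᵇ p (x ∷ xs)) ≡ ind (p x) + List.length (List.filterᵇ p xs)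
length-filter-∷ p x xs with p x
... | true  = refl
... | false = refl

count-vec : ∀ {n} (p : BoolFun n) → Ext p → count p ≡ ∑ bits (ind ∘ vec p)
count-vec {zero} p e = trans (length-filter-∷ p _ []) (trans (+-identityʳ _) (cong ind (e (λ ()))))
count-vec {suc n} p e = trans (split (allInputs n)) (cong₂ _+_ (part true) (part false))
  where
    #[_] : ∀ {k} → BoolFun k → List (Input k) → ℕ
    #[ q ] xs = List.length (List.filterᵇ q xs)
    eq : ∀ a b c d → a + (b + (c + d)) ≡ (a + c) + (b + d)
    eq = solve-∀
    -- The enumeration interleaves the two values of the first coordinate, whereas the sum over
    -- vectors takes one half after the other.
    split : ∀ xs → #[ p ] (List.concatMap (λ x → (true ∷ᶠ x) ∷ (false ∷ᶠ x) ∷ []) xs) ≡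
      #[ (λ x → p (true ∷ᶠ x)) ] xs + #[ (λ x → p (false ∷ᶠ x)) ] xs
    split [] = refl
    split (x ∷ xs) = trans
      (trans (length-filter-∷ p (true ∷ᶠ x) _) (cong (λ z → ind (p (true ∷ᶠ x)) + z)
        (trans (length-filter-∷ p (false ∷ᶠ x) _) (cong (λ z → ind (p (false ∷ᶠ x)) + z) (split xs)))))
      (trans (eq (ind (p (true ∷ᶠ x))) (ind (p (false ∷ᶠ x))) _ _)
        (sym (cong₂ _+_ (length-filter-∷ (λ x → p (true ∷ᶠ x)) x xs) (length-filter-∷ (λ x → p (false ∷ᶠ x)) x xs))))
    part : ∀ b → count (λ x → p (b ∷ᶠ x)) ≡ ∑ bits (λ v → ind (p (lookup (b ∷ v))))
    part b = trans (count-vec (λ x → p (b ∷ᶠ x)) (λ h → e (∷ᶠ-cong b h)))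
                   (∑-cong bits (λ v → cong ind (e (lookup-∷ b v))))

flipV : ∀ {n} → Fin n → Vec Bool n → Vec Bool n
flipV zero    (b ∷ x) = not b ∷ x
flipV (suc i) (b ∷ x) = b ∷ flipV i x

lookup-flipV : ∀ {n} (i : Fin n) v j → flipAt i (lookup v) j ≡ lookup (flipV i v) j
lookup-flipV zero    (b ∷ v) zero    = refl
lookup-flipV zero    (b ∷ v) (suc j) = refl
lookup-flipV (suc i) (b ∷ v) zero    = refl
lookup-flipV (suc i) (b ∷ v) (suc j) = lookup-flipV i v j

influence : ∀ {n} → Fun n → Fin n → ℕ
influence f i = ∑ bits (λ v → ind (f v xor f (flipV i v)))

flipAt-cong : ∀ {n} (i : Fin n) {x y : Input n} → (∀ j → x j ≡ y j) → ∀ j → flipAt i x j ≡ flipAt i y j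
flipAt-cong i h j with does (i ≟ j)
... | true  = cong not (h j)
... | false = h j

influence-vec : ∀ {n} (f : BoolFun n) → Ext f → ∀ i → count (λ x → f x xor f (flipAt i x)) ≡ influence (vec f) i
influence-vec f e i = trans
  (count-vec _ (λ h → cong₂ _xor_ (e h) (e (flipAt-cong i h))))
  (∑-cong bits (λ v → cong (λ b → ind (f (lookup v) xor b)) (e (lookup-flipV i v))))

-- This concerns the influences, not how often `f` takes each value.
Balanced : ∀ {n} → Fun n → Set
Balanced {n} f = ∀ i → 2 * influence f i ≡ 2 ^ n

sumFinℕ : ∀ {n} → (Fin n → ℕ) → ℕ
sumFinℕ {zero}  g = 0
sumFinℕ {suc n} g = g zero + sumFinℕ (g ∘ suc)

sens-sum : ∀ {n} (f : Fun n) v → sens f v ≡ sumFinℕ (λ i → ind (f v xor f (flipV i v)))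
sens-sum f []      = refl
sens-sum f (b ∷ v) = cong (λ z → ind (f (b ∷ v) xor f (not b ∷ v)) + z) (sens-sum (f ∘ (b ∷_)) v)

∑-sumFin : ∀ {n} k (F : Fin k → Vec Bool n → ℕ) → ∑ bits (λ v → sumFinℕ (λ i → F i v)) ≡ sumFinℕ (λ i → ∑ bits (F i))
∑-sumFin {n} zero F = ∑-const bits n 0
∑-sumFin (suc k)  F = trans (∑-+ bits (F zero) (λ v → sumFinℕ (λ i → F (suc i) v)))
                            (cong (λ z → ∑ bits (F zero) + z) (∑-sumFin k (F ∘ suc)))

N-balanced : ∀ {n} (f : Fun n) → Balanced f → 2 * N f ≡ n * 2 ^ n
N-balanced {n} f bal = trans
  (cong (2 *_) (trans (∑-cong bits (sens-sum f)) (∑-sumFin n (λ i v → ind (f v xor f (flipV i v))))))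
  (add n (influence f) bal)
  where
    add : ∀ k (g : Fin k → ℕ) → (∀ i → 2 * g i ≡ 2 ^ n) → 2 * sumFinℕ g ≡ k * 2 ^ n
    add zero    g h = refl
    add (suc k) g h = trans (*-distribˡ-+ 2 (g zero) _) (cong₂ _+_ (h zero) (add k (g ∘ suc) (h ∘ suc)))

sens-cong : ∀ {n} {f g : Fun n} → (∀ v → f v ≡ g v) → ∀ v → sens f v ≡ sens g v
sens-cong h []      = refl
sens-cong h (b ∷ v) = cong₂ (λ x y → ind x + y) (cong₂ _xor_ (h (b ∷ v)) (h (not b ∷ v))) (sens-cong (λ w → h (b ∷ w)) v)

N-cong : ∀ {n} {f g : Fun n} → (∀ v → f v ≡ g v) → N f ≡ N g
N-cong h = ∑-cong bits (sens-cong h)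

-- Propagation criterion

card-sum : ∀ {n} (S : SubsetN n) → card S ≡ sumFinℕ (ind ∘ S)
card-sum {n} S = go n S id
  where
    go : ∀ k {m} (S : Fin m → Bool) (g : Fin k → Fin m) →
      List.length (List.filterᵇ S (List.tabulate g)) ≡ sumFinℕ (λ i → ind (S (g i)))
    go zero    S g = refl
    go (suc k) S g = trans (length-filter-∷ S (g zero) _) (cong (λ z → ind (S (g zero)) + z) (go k S (g ∘ suc)))

sumFin-0 : ∀ k → sumFinℕ {k} (λ _ → 0) ≡ 0
sumFin-0 zero    = refl
sumFin-0 (suc k) = sumFin-0 k

card-singleton : ∀ {n} (i : Fin n) → card (λ j → does (i ≟ j)) ≡ 1
card-singleton i = trans (card-sum (λ j → does (i ≟ j))) (go i)
  where
    go : ∀ {n} (i : Fin n) → sumFinℕ (λ j → ind (does (i ≟ j))) ≡ 1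
    go {suc n} zero    = cong suc (sumFin-0 n)
    go {suc n} (suc i) = go i

-- `flipSet` at the singleton `does (i ≟ j)` is definitionally `flipAt i`, so that instance of the
-- criterion is already the claim about i.
PC⇒balanced : ∀ {n} (f : BoolFun n) → Ext f → ∀ k → 1 ≤ k → PCk n k f → Balanced (vec f)
PC⇒balanced f e k 1≤k pc i = trans (cong (2 *_) (sym (influence-vec f e i)))
  (pc (λ j → does (i ≟ j)) (≤-reflexive (sym (card-singleton i))) (≤-trans (≤-reflexive (card-singleton i)) 1≤k))

-- Strict avalanche criterion of higher order

-- A point z arises from exactly 2^n pairs: α is prescribed on `m` and v off `m`, the remaining
-- entries being arbitrary.
∑-override : ∀ {n} (m : Vec Bool n) (F : Vec Bool n → ℕ) →
  ∑ bits (λ α → ∑ bits (λ v → F (override m α v))) ≡ 2 ^ n * ∑ bits F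
∑-override []      F = sym (+-identityʳ _)
∑-override {suc n} (b ∷ m) F = trans (cong₂ _+_ (outer b true) (outer b false)) (combine b)
  where
    s : Bool → ℕ
    s c = ∑ bits (λ v → F (c ∷ v))
    pick : Bool → Bool → Bool → Bool
    pick b a v = if b then a else v
    outer : ∀ b a → ∑ bits (λ α → ∑ bits (λ v → F (override (b ∷ m) (a ∷ α) v))) ≡
      2 ^ n * s (pick b a true) + 2 ^ n * s (pick b a false)
    outer true  a = trans (∑-+ bits _ (λ α → ∑ bits (λ v → F (a ∷ override m α v))))
      (cong₂ _+_ (∑-override m (λ v → F (a ∷ v))) (∑-override m (λ v → F (a ∷ v))))
    outer false a = trans (∑-+ bits _ (λ α → ∑ bits (λ v → F (false ∷ override m α v))))
      (cong₂ _+_ (∑-override m (λ v → F (true ∷ v))) (∑-override m (λ v → F (false ∷ v))))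
    combine : ∀ b → (2 ^ n * s (pick b true true) + 2 ^ n * s (pick b true false))
      + (2 ^ n * s (pick b false true) + 2 ^ n * s (pick b false false)) ≡ 2 * 2 ^ n * (s true + s false)
    combine true  = eq (2 ^ n) (s true) (s false)
      where
        eq : ∀ p x y → (p * x + p * x) + (p * y + p * y) ≡ 2 * p * (x + y)
        eq = solve-∀
    combine false = eq (2 ^ n) (s true) (s false)
      where
        eq : ∀ p x y → (p * x + p * y) + (p * x + p * y) ≡ 2 * p * (x + y)
        eq = solve-∀

lookup-override : ∀ {n} (m α v : Vec Bool n) j →
  (if lookup m j then lookup α j else lookup v j) ≡ lookup (override m α v) j
lookup-override (true ∷ m)  (a ∷ α) (b ∷ v) zero    = refl
lookup-override (false ∷ m) (a ∷ α) (b ∷ v) zero    = refl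
lookup-override (true ∷ m)  (a ∷ α) (b ∷ v) (suc j) = lookup-override m α v j
lookup-override (false ∷ m) (a ∷ α) (b ∷ v) (suc j) = lookup-override m α v j

override-flipV : ∀ {n} (m α v : Vec Bool n) i → lookup m i ≡ false → override m α (flipV i v) ≡ flipV i (override m α v)
override-flipV (false ∷ m) (a ∷ α) (b ∷ v) zero    h = refl
override-flipV (true ∷ m)  (a ∷ α) (b ∷ v) (suc i) h = cong (a ∷_) (override-flipV m α v i h)
override-flipV (false ∷ m) (a ∷ α) (b ∷ v) (suc i) h = cong (b ∷_) (override-flipV m α v i h)

prefix : ∀ k n → k ≤ n → Σ (Vec Bool n) λ m → ∥ m ∥ ≡ k
prefix zero    n       z≤n      = replicate n false , ∥none∥ n
prefix (suc k) (suc n) (s≤s le) = true ∷ proj₁ (prefix k n le) , cong suc (proj₂ (prefix k n le))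

avoiding : ∀ {n} (i : Fin n) k → k < n → Σ (Vec Bool n) λ m → ∥ m ∥ ≡ k × lookup m i ≡ false
avoiding {suc n} zero k (s≤s k≤n) = false ∷ proj₁ (prefix k n k≤n) , proj₂ (prefix k n k≤n) , refl
avoiding {suc n} (suc i) zero _ with avoiding i 0 (≤-trans (s≤s z≤n) (fin<n i))
  where
    fin<n : ∀ {n} → Fin n → 0 < n
    fin<n {suc n} _ = s≤s z≤n
... | m , p , q = false ∷ m , p , q
avoiding {suc n} (suc i) (suc k) (s≤s k<n) with avoiding i k k<n
... | m , p , q = true ∷ m , cong suc p , q

∥∥-sum : ∀ {n} (m : Vec Bool n) → sumFinℕ (ind ∘ lookup m) ≡ ∥ m ∥
∥∥-sum []      = refl
∥∥-sum (b ∷ m) = cong (λ z → ind b + z) (∥∥-sum m)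

-- One k-element set avoiding i is enough: averaging over all values α of its variables turns the
-- influences of the restricted functions into that of `f`.
SACk⇒balanced : ∀ {n} (f : BoolFun n) → Ext f → ∀ k → k < n → SACk n k f → Balanced (vec f)
SACk⇒balanced {n} f e k k<n sac i with avoiding i k k<n
... | m , ∥m∥≡k , m∌i = *-cancelˡ-≡ _ _ (2 ^ n) {{m^n≢0 2 n}} (begin
  2 ^ n * (2 * influence (vec f) i)                           ≡⟨ eq (2 ^ n) _ ⟩
  2 * (2 ^ n * ∑ bits G)                                      ≡⟨ cong (2 *_) (sym (∑-override m G)) ⟩
  2 * ∑ bits (λ α → ∑ bits (λ v → G (override m α v)))        ≡⟨ sym (∑-* bits 2 (λ α → ∑ bits (λ v → G (override m α v)))) ⟩
  ∑ bits (λ α → 2 * ∑ bits (λ v → G (override m α v)))        ≡⟨ ∑-cong bits restricted ⟩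
  ∑ bits {n} (λ α → 2 ^ n)                                    ≡⟨ ∑-const bits n (2 ^ n) ⟩
  2 ^ n * 2 ^ n                                               ∎)
  where
    open ≡-Reasoning
    G : Vec Bool n → ℕ
    G z = ind (vec f z xor vec f (flipV i z))
    eq : ∀ p x → p * (2 * x) ≡ 2 * (p * x)
    eq = solve-∀
    g : Vec Bool n → BoolFun n
    g α = restrict f (lookup m) (lookup α)
    choose-cong : ∀ b (a : Bool) {x y : Bool} → x ≡ y → (if b then a else x) ≡ (if b then a else y)
    choose-cong b a h = cong (if b then a else_) h
    restricted : ∀ α → 2 * ∑ bits (λ v → G (override m α v)) ≡ 2 ^ n
    restricted α = trans
      (cong (2 *_) (trans
        (∑-cong bits (λ v → cong₂ (λ x y → ind (x xor y))
          (sym (e (lookup-override m α v)))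
          (trans (cong (vec f) (sym (override-flipV m α v i m∌i))) (sym (e (lookup-override m α (flipV i v)))))))
        (sym (influence-vec (g α) (λ h → e (λ j → choose-cong (lookup m j) (lookup α j) (h j))) i))))
      (sac (lookup m) (trans (card-sum (lookup m)) (trans (∥∥-sum m) ∥m∥≡k)) (lookup α) i m∌i)

-- Fourier analysis

∑ℤ : ∀ {n} → (Vec Bool n → ℤ) → ℤ
∑ℤ {zero}  F = F []
∑ℤ {suc n} F = ∑ℤ (λ v → F (true ∷ v)) ℤ.+ ∑ℤ (λ v → F (false ∷ v))

∑ℤ-cong : ∀ {n} {F G : Vec Bool n → ℤ} → (∀ v → F v ≡ G v) → ∑ℤ F ≡ ∑ℤ G
∑ℤ-cong {zero}  h = h []
∑ℤ-cong {suc n} h = cong₂ ℤ._+_ (∑ℤ-cong (λ v → h (true ∷ v))) (∑ℤ-cong (λ v → h (false ∷ v)))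

∑ℤ-+ : ∀ {n} (F G : Vec Bool n → ℤ) → ∑ℤ (λ v → F v ℤ.+ G v) ≡ ∑ℤ F ℤ.+ ∑ℤ G
∑ℤ-+ {zero}  F G = refl
∑ℤ-+ {suc n} F G = trans
  (cong₂ ℤ._+_ (∑ℤ-+ (λ v → F (true ∷ v)) (λ v → G (true ∷ v))) (∑ℤ-+ (λ v → F (false ∷ v)) (λ v → G (false ∷ v))))
  (eq (∑ℤ (λ v → F (true ∷ v))) (∑ℤ (λ v → G (true ∷ v))) (∑ℤ (λ v → F (false ∷ v))) (∑ℤ (λ v → G (false ∷ v))))
  where
    eq : ∀ a b c d → (a ℤ.+ b) ℤ.+ (c ℤ.+ d) ≡ (a ℤ.+ c) ℤ.+ (b ℤ.+ d)
    eq = ℤ-Solver.solve-∀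

∑ℤ-* : ∀ {n} k (F : Vec Bool n → ℤ) → ∑ℤ (λ v → k ℤ.* F v) ≡ k ℤ.* ∑ℤ F
∑ℤ-* {zero}  k F = refl
∑ℤ-* {suc n} k F = trans (cong₂ ℤ._+_ (∑ℤ-* k (λ v → F (true ∷ v))) (∑ℤ-* k (λ v → F (false ∷ v))))
                         (sym (ℤₚ.*-distribˡ-+ k _ _))

∑ℤ-ℕ : ∀ {n} (F : Vec Bool n → ℕ) → ∑ℤ (λ v → + F v) ≡ + ∑ bits F
∑ℤ-ℕ {zero}  F = refl
∑ℤ-ℕ {suc n} F = trans (cong₂ ℤ._+_ (∑ℤ-ℕ (λ v → F (true ∷ v))) (∑ℤ-ℕ (λ v → F (false ∷ v))))
  (sym (ℤₚ.pos-+ (∑ bits (λ v → F (true ∷ v))) _))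

∑ℤ-1 : ∀ n → ∑ℤ {n} (λ _ → + 1) ≡ + (2 ^ n)
∑ℤ-1 n = trans (∑ℤ-ℕ {n} (λ _ → 1)) (cong +_ (trans (∑-const bits n 1) (*-identityˡ (2 ^ n))))

side : Bool → Bool → ℤ
side s b = if s then toℤ b else + 1

χ : ∀ {n} → Vec Bool n → Vec Bool n → ℤ
χ []      []      = + 1
χ (s ∷ S) (b ∷ x) = side s b ℤ.* χ S x

hat : ∀ {n} → (Vec Bool n → ℤ) → Vec Bool n → ℤ
hat u S = ∑ℤ (λ v → u v ℤ.* χ S v)

hat-∷ : ∀ {n} (u : Vec Bool (suc n) → ℤ) s S →
  hat u (s ∷ S) ≡ hat (u ∘ (true ∷_)) S ℤ.+ side s false ℤ.* hat (u ∘ (false ∷_)) S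
hat-∷ u s S = cong₂ ℤ._+_
  (∑ℤ-cong (λ v → trans (cong (λ z → u (true ∷ v) ℤ.* (z ℤ.* χ S v)) (side-true s)) (cong (u (true ∷ v) ℤ.*_) (ℤₚ.*-identityˡ (χ S v)))))
  (trans (∑ℤ-cong (λ v → eq (u (false ∷ v)) (side s false) (χ S v))) (∑ℤ-* (side s false) (λ v → u (false ∷ v) ℤ.* χ S v)))
  where
    side-true : ∀ s → side s true ≡ + 1
    side-true true  = refl
    side-true false = refl
    eq : ∀ a b c → a ℤ.* (b ℤ.* c) ≡ b ℤ.* (a ℤ.* c)
    eq = ℤ-Solver.solve-∀

-- By halves: (a - b)(c - d) + (a + b)(c + d) = 2(ac + bd). The unnormalised coefficients account
-- for the factor 2^n.
plancherel : ∀ {n} (u w : Vec Bool n → ℤ) → ∑ℤ (λ S → hat u S ℤ.* hat w S) ≡ + (2 ^ n) ℤ.* ∑ℤ (λ v → u v ℤ.* w v)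
plancherel {zero} u w = eq (u []) (w [])
  where
    eq : ∀ a b → a ℤ.* + 1 ℤ.* (b ℤ.* + 1) ≡ + 1 ℤ.* (a ℤ.* b)
    eq = ℤ-Solver.solve-∀
plancherel {suc n} u w = begin
  ∑ℤ (λ S → hat u (true ∷ S) ℤ.* hat w (true ∷ S)) ℤ.+ ∑ℤ (λ S → hat u (false ∷ S) ℤ.* hat w (false ∷ S))
    ≡⟨ sym (∑ℤ-+ (λ S → hat u (true ∷ S) ℤ.* hat w (true ∷ S)) (λ S → hat u (false ∷ S) ℤ.* hat w (false ∷ S))) ⟩
  ∑ℤ (λ S → hat u (true ∷ S) ℤ.* hat w (true ∷ S) ℤ.+ hat u (false ∷ S) ℤ.* hat w (false ∷ S))
    ≡⟨ ∑ℤ-cong (λ S → trans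
         (cong₂ ℤ._+_ (cong₂ ℤ._*_ (hat-∷ u true S) (hat-∷ w true S)) (cong₂ ℤ._*_ (hat-∷ u false S) (hat-∷ w false S)))
         (eq₁ (hat (u ∘ (true ∷_)) S) (hat (u ∘ (false ∷_)) S) (hat (w ∘ (true ∷_)) S) (hat (w ∘ (false ∷_)) S))) ⟩
  ∑ℤ (λ S → + 2 ℤ.* (P true S ℤ.+ P false S))
    ≡⟨ trans (∑ℤ-* (+ 2) (λ S → P true S ℤ.+ P false S)) (cong (+ 2 ℤ.*_) (∑ℤ-+ (P true) (P false))) ⟩
  + 2 ℤ.* (∑ℤ (P true) ℤ.+ ∑ℤ (P false))
    ≡⟨ cong (+ 2 ℤ.*_) (cong₂ ℤ._+_ (plancherel (u ∘ (true ∷_)) (w ∘ (true ∷_))) (plancherel (u ∘ (false ∷_)) (w ∘ (false ∷_)))) ⟩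
  + 2 ℤ.* (+ (2 ^ n) ℤ.* A true ℤ.+ + (2 ^ n) ℤ.* A false)
    ≡⟨ eq₂ (+ (2 ^ n)) (A true) (A false) ⟩
  + 2 ℤ.* + (2 ^ n) ℤ.* (A true ℤ.+ A false)
    ≡⟨ cong (ℤ._* (A true ℤ.+ A false)) (sym (ℤₚ.pos-* 2 (2 ^ n))) ⟩
  + (2 ^ suc n) ℤ.* (A true ℤ.+ A false) ∎
  where
    open ≡-Reasoning
    P : Bool → Vec Bool n → ℤ
    P b S = hat (u ∘ (b ∷_)) S ℤ.* hat (w ∘ (b ∷_)) S
    A : Bool → ℤ
    A b = ∑ℤ (λ v → u (b ∷ v) ℤ.* w (b ∷ v))
    eq₁ : ∀ a b c d → (a ℤ.+ - (+ 1) ℤ.* b) ℤ.* (c ℤ.+ - (+ 1) ℤ.* d) ℤ.+ (a ℤ.+ + 1 ℤ.* b) ℤ.* (c ℤ.+ + 1 ℤ.* d)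
                    ≡ + 2 ℤ.* (a ℤ.* c ℤ.+ b ℤ.* d)
    eq₁ = ℤ-Solver.solve-∀
    eq₂ : ∀ p a b → + 2 ℤ.* (p ℤ.* a ℤ.+ p ℤ.* b) ≡ + 2 ℤ.* p ℤ.* (a ℤ.+ b)
    eq₂ = ℤ-Solver.solve-∀

sgn : ∀ {n} → Fin n → Vec Bool n → ℤ
sgn i S = toℤ (not (lookup S i))

-- Negating coordinate i changes the sign of the character of S exactly when i lies in S.
hat-flipV : ∀ {n} (u : Vec Bool n → ℤ) i S → hat (u ∘ flipV i) S ≡ sgn i S ℤ.* hat u S
hat-flipV u zero (s ∷ S) = trans (hat-∷ (u ∘ flipV zero) s S)
  (trans (swap s) (cong (toℤ (not s) ℤ.*_) (sym (hat-∷ u s S))))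
  where
    a = hat (u ∘ (true ∷_)) S
    b = hat (u ∘ (false ∷_)) S
    swap : ∀ s → b ℤ.+ side s false ℤ.* a ≡ toℤ (not s) ℤ.* (a ℤ.+ side s false ℤ.* b)
    swap true  = eq a b
      where
        eq : ∀ a b → b ℤ.+ - (+ 1) ℤ.* a ≡ - (+ 1) ℤ.* (a ℤ.+ - (+ 1) ℤ.* b)
        eq = ℤ-Solver.solve-∀
    swap false = eq a b
      where
        eq : ∀ a b → b ℤ.+ + 1 ℤ.* a ≡ + 1 ℤ.* (a ℤ.+ + 1 ℤ.* b)
        eq = ℤ-Solver.solve-∀
hat-flipV u (suc i) (s ∷ S) = trans (hat-∷ (u ∘ flipV (suc i)) s S)
  (trans (cong₂ (λ x y → x ℤ.+ side s false ℤ.* y) (hat-flipV (u ∘ (true ∷_)) i S) (hat-flipV (u ∘ (false ∷_)) i S))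
    (trans (eq (sgn i S) (hat (u ∘ (true ∷_)) S) (side s false) (hat (u ∘ (false ∷_)) S))
      (cong (sgn i S ℤ.*_) (sym (hat-∷ u s S)))))
  where
    eq : ∀ g a e b → g ℤ.* a ℤ.+ e ℤ.* (g ℤ.* b) ≡ g ℤ.* (a ℤ.+ e ℤ.* b)
    eq = ℤ-Solver.solve-∀

∑-sgn : ∀ {n} (i : Fin n) → ∑ℤ (sgn i) ≡ + 0
∑-sgn {suc n} zero = trans (cong (ℤ._+ ∑ℤ {n} (λ _ → + 1)) (∑ℤ-* {n} (- (+ 1)) (λ _ → + 1))) (eq (∑ℤ {n} (λ _ → + 1)))
  where
    eq : ∀ a → - (+ 1) ℤ.* a ℤ.+ a ≡ + 0
    eq = ℤ-Solver.solve-∀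
∑-sgn (suc i) = cong₂ ℤ._+_ (∑-sgn i) (∑-sgn i)

toℤ-xor : ∀ a b → toℤ a ℤ.* toℤ b ℤ.+ + 2 ℤ.* + ind (a xor b) ≡ + 1
toℤ-xor true  true  = refl
toℤ-xor true  false = refl
toℤ-xor false true  = refl
toℤ-xor false false = refl

-- All squared coefficients equal m², so the correlation of f with its flip is a multiple of the sum
-- of `sgn i S` over S. This vanishes because half of all sets contain i, and correlation 0 means
-- that the flip changes f half of the time.
flat⇒balanced : ∀ {n} (f : Fun n) m → (∀ S → hat (toℤ ∘ f) S ≡ + m ⊎ hat (toℤ ∘ f) S ≡ - (+ m)) → Balanced f
flat⇒balanced {n} f m flat i = ℤₚ.+-injective (begin
  + (2 * influence f i)                            ≡⟨ ℤₚ.pos-* 2 (influence f i) ⟩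
  + 2 ℤ.* + influence f i                          ≡⟨ sym (ℤₚ.+-identityˡ _) ⟩
  + 0 ℤ.+ + 2 ℤ.* + influence f i                  ≡⟨ cong (λ z → z ℤ.+ + 2 ℤ.* + influence f i) (sym uncorrelated) ⟩
  ∑ℤ (λ v → u v ℤ.* u (flipV i v)) ℤ.+ + 2 ℤ.* + influence f i
    ≡⟨ cong (λ z → ∑ℤ (λ v → u v ℤ.* u (flipV i v)) ℤ.+ z)
         (sym (trans (∑ℤ-* (+ 2) (λ v → + ind (f v xor f (flipV i v)))) (cong (+ 2 ℤ.*_) (∑ℤ-ℕ (λ v → ind (f v xor f (flipV i v))))))) ⟩
  ∑ℤ (λ v → u v ℤ.* u (flipV i v)) ℤ.+ ∑ℤ (λ v → + 2 ℤ.* + ind (f v xor f (flipV i v)))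
    ≡⟨ sym (∑ℤ-+ (λ v → u v ℤ.* u (flipV i v)) (λ v → + 2 ℤ.* + ind (f v xor f (flipV i v)))) ⟩
  ∑ℤ (λ v → u v ℤ.* u (flipV i v) ℤ.+ + 2 ℤ.* + ind (f v xor f (flipV i v)))
    ≡⟨ ∑ℤ-cong (λ v → toℤ-xor (f v) (f (flipV i v))) ⟩
  ∑ℤ {n} (λ _ → + 1)                               ≡⟨ ∑ℤ-1 n ⟩
  + (2 ^ n)                                        ∎)
  where
    open ≡-Reasoning
    u : Vec Bool n → ℤ
    u = toℤ ∘ f
    square : ∀ S → hat u S ℤ.* hat u S ≡ + m ℤ.* + m
    square S with flat S
    ... | inj₁ p = cong₂ ℤ._*_ p p
    ... | inj₂ p = trans (cong₂ ℤ._*_ p p) (eq (+ m))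
      where
        eq : ∀ a → - a ℤ.* - a ≡ a ℤ.* a
        eq = ℤ-Solver.solve-∀
    uncorrelated : ∑ℤ (λ v → u v ℤ.* u (flipV i v)) ≡ + 0
    uncorrelated = ℤₚ.*-cancelˡ-≡ (+ (2 ^ n)) _ _ {{m^n≢0 2 n}} (begin
      + (2 ^ n) ℤ.* ∑ℤ (λ v → u v ℤ.* u (flipV i v))        ≡⟨ sym (plancherel u (u ∘ flipV i)) ⟩
      ∑ℤ (λ S → hat u S ℤ.* hat (u ∘ flipV i) S)            ≡⟨ ∑ℤ-cong (λ S → trans (cong (hat u S ℤ.*_) (hat-flipV u i S))
                                                                (trans (eq (hat u S) (sgn i S)) (cong (ℤ._* sgn i S) (square S)))) ⟩
      ∑ℤ (λ S → + m ℤ.* + m ℤ.* sgn i S)                    ≡⟨ ∑ℤ-* (+ m ℤ.* + m) (sgn i) ⟩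
      + m ℤ.* + m ℤ.* ∑ℤ (sgn i)                            ≡⟨ cong (+ m ℤ.* + m ℤ.*_) (∑-sgn i) ⟩
      + m ℤ.* + m ℤ.* + 0                                   ≡⟨ ℤₚ.*-zeroʳ (+ m ℤ.* + m) ⟩
      + 0                                                   ≡⟨ sym (ℤₚ.*-zeroʳ (+ (2 ^ n))) ⟩
      + (2 ^ n) ℤ.* + 0                                     ∎)
      where
        eq : ∀ a g → a ℤ.* (g ℤ.* a) ≡ a ℤ.* a ℤ.* g
        eq = ℤ-Solver.solve-∀

sumInputs-vec : ∀ {n} (F : Input n → ℤ) → Ext F → List.foldr ℤ._+_ (+ 0) (List.map F (allInputs n)) ≡ ∑ℤ (λ v → F (lookup v))
sumInputs-vec {zero} F e = trans (ℤₚ.+-identityʳ _) (e (λ ()))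
sumInputs-vec {suc n} F e = trans (split (allInputs n)) (cong₂ ℤ._+_ (part true) (part false))
  where
    sum : List ℤ → ℤ
    sum = List.foldr ℤ._+_ (+ 0)
    eq : ∀ a b c d → a ℤ.+ (b ℤ.+ (c ℤ.+ d)) ≡ (a ℤ.+ c) ℤ.+ (b ℤ.+ d)
    eq = ℤ-Solver.solve-∀
    split : ∀ xs → sum (List.map F (List.concatMap (λ x → (true ∷ᶠ x) ∷ (false ∷ᶠ x) ∷ []) xs)) ≡
      sum (List.map (λ x → F (true ∷ᶠ x)) xs) ℤ.+ sum (List.map (λ x → F (false ∷ᶠ x)) xs)
    split []       = refl
    split (x ∷ xs) = trans (cong (λ z → F (true ∷ᶠ x) ℤ.+ (F (false ∷ᶠ x) ℤ.+ z)) (split xs))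
                           (eq (F (true ∷ᶠ x)) (F (false ∷ᶠ x)) _ _)
    part : ∀ b → sum (List.map (λ x → F (b ∷ᶠ x)) (allInputs n)) ≡ ∑ℤ (λ v → F (lookup (b ∷ v)))
    part b = trans (sumInputs-vec (λ x → F (b ∷ᶠ x)) (λ h → e (∷ᶠ-cong b h))) (∑ℤ-cong (λ v → e (lookup-∷ b v)))

chi-vec : ∀ {n} (S v : Vec Bool n) → chi (lookup S) (lookup v) ≡ χ S v
chi-vec {n} S v = trans (cong (List.foldr ℤ._*_ (+ 1)) (Listₚ.map-tabulate id (λ i → side (lookup S i) (lookup v i)))) (go S v)
  where
    go : ∀ {n} (S v : Vec Bool n) → List.foldr ℤ._*_ (+ 1) (List.tabulate (λ i → side (lookup S i) (lookup v i))) ≡ χ S v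
    go []      []      = refl
    go (s ∷ S) (b ∷ v) = cong (side s b ℤ.*_) (go S v)

chi-cong : ∀ {n} (S : SubsetN n) → Ext (chi S)
chi-cong {n} S h = cong (List.foldr ℤ._*_ (+ 1)) (Listₚ.map-cong (λ i → cong (λ b → if S i then toℤ b else + 1) (h i)) (List.allFin n))

fourier-vec : ∀ {n} (f : BoolFun n) → Ext f → ∀ S → fourier2n f (lookup S) ≡ hat (toℤ ∘ vec f) S
fourier-vec f e S = trans
  (sumInputs-vec (λ x → toℤ (f x) ℤ.* chi (lookup S) x) (λ h → cong₂ (λ b z → toℤ b ℤ.* z) (e h) (chi-cong (lookup S) h)))
  (∑ℤ-cong (λ v → cong (toℤ (vec f v) ℤ.*_) (chi-vec S v)))

X⇒balanced : ∀ {n} (f : BoolFun n) → Ext f → InX n f → Balanced (vec f)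
X⇒balanced f e (inj₁ (m , _ , bent)) = flat⇒balanced (vec f) (2 ^ m) flat
  where
    flat : ∀ S → _
    flat S with bent (lookup S)
    ... | inj₁ p = inj₁ (trans (sym (fourier-vec f e S)) p)
    ... | inj₂ p = inj₂ (trans (sym (fourier-vec f e S)) p)
X⇒balanced f e (inj₂ (inj₁ (k , k+2≤n , sac))) =
  SACk⇒balanced f e k (≤-trans (≤-reflexive (+-comm 1 k)) (≤-trans (+-monoʳ-≤ k (s≤s z≤n)) k+2≤n)) sac
X⇒balanced f e (inj₂ (inj₂ (k , 1≤k , _ , pc))) = PC⇒balanced f e k 1≤k pc

-- Unate functions

-- σ gives, for each coordinate, the value towards which f increases.
Unate : ∀ {n} → Vec Bool n → Fun n → Set
Unate []      f = ⊤
Unate (s ∷ σ) f = (∀ v → f (not s ∷ v) ≤ᵇ f (s ∷ v)) × (∀ b → Unate σ (f ∘ (b ∷_)))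

score : ∀ {n} → Vec Bool n → Vec Bool n → ℤ
score []      []      = + 0
score (s ∷ σ) (b ∷ v) = toℤ s ℤ.* toℤ b ℤ.+ score σ v

increase : ∀ s a b → (if s then b ≤ᵇ a else a ≤ᵇ b) →
  toℤ s ℤ.* + 1 ℤ.* toℤ a ℤ.+ toℤ s ℤ.* - (+ 1) ℤ.* toℤ b ≡ + 2 ℤ.* + ind (a xor b)
increase true  true  true  h = refl
increase true  true  false h = refl
increase true  false false h = refl
increase false true  true  h = refl
increase false false true  h = refl
increase false false false h = refl
increase true  false true  ()
increase false true  false ()

-- Unateness fixes the sign of every difference of `f`, so the degree-one coefficient at i, taken
-- with the sign of σ at i, is the influence of i; these add up to the correlation with the score.
∑-score : ∀ {n} (σ : Vec Bool n) f → Unate σ f → ∑ℤ (λ v → toℤ (f v) ℤ.* score σ v) ≡ + N f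
∑-score [] f u = ℤₚ.*-zeroʳ (toℤ (f []))
∑-score {suc n} (s ∷ σ) f (up , u) = begin
  ∑ℤ (λ v → toℤ (f (true ∷ v)) ℤ.* score (s ∷ σ) (true ∷ v)) ℤ.+ ∑ℤ (λ v → toℤ (f (false ∷ v)) ℤ.* score (s ∷ σ) (false ∷ v))
    ≡⟨ sym (∑ℤ-+ (λ v → toℤ (f (true ∷ v)) ℤ.* score (s ∷ σ) (true ∷ v)) (λ v → toℤ (f (false ∷ v)) ℤ.* score (s ∷ σ) (false ∷ v))) ⟩
  ∑ℤ (λ v → toℤ (f (true ∷ v)) ℤ.* score (s ∷ σ) (true ∷ v) ℤ.+ toℤ (f (false ∷ v)) ℤ.* score (s ∷ σ) (false ∷ v))
    ≡⟨ ∑ℤ-cong (λ v → trans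
         (eq₁ (toℤ (f (true ∷ v))) (toℤ (f (false ∷ v))) (score σ v) (toℤ s ℤ.* + 1) (toℤ s ℤ.* - (+ 1)))
         (cong (λ y → part true v ℤ.+ part false v ℤ.+ y) (increase s (f (true ∷ v)) (f (false ∷ v)) (ordered s v (up v))))) ⟩
  ∑ℤ (λ v → part true v ℤ.+ part false v ℤ.+ + 2 ℤ.* jump v)
    ≡⟨ trans (∑ℤ-+ (λ v → part true v ℤ.+ part false v) (λ v → + 2 ℤ.* jump v))
             (cong₂ ℤ._+_ (∑ℤ-+ (part true) (part false)) (∑ℤ-* (+ 2) jump)) ⟩
  ∑ℤ (part true) ℤ.+ ∑ℤ (part false) ℤ.+ + 2 ℤ.* ∑ℤ jump
    ≡⟨ cong₂ ℤ._+_ (cong₂ ℤ._+_ (∑-score σ (f ∘ (true ∷_)) (u true)) (∑-score σ (f ∘ (false ∷_)) (u false)))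
                   (cong (+ 2 ℤ.*_) (∑ℤ-ℕ (λ v → ind (f (true ∷ v) xor f (false ∷ v))))) ⟩
  + N (f ∘ (true ∷_)) ℤ.+ + N (f ∘ (false ∷_)) ℤ.+ + 2 ℤ.* + D
    ≡⟨ cong (λ z → + (N (f ∘ (true ∷_)) + N (f ∘ (false ∷_))) ℤ.+ z) (sym (ℤₚ.pos-* 2 D)) ⟩
  + (N (f ∘ (true ∷_)) + N (f ∘ (false ∷_)) + 2 * D)
    ≡⟨ cong +_ (sym (N-suc f)) ⟩
  + N f ∎
  where
    open ≡-Reasoning
    D = diff (f ∘ (true ∷_)) (f ∘ (false ∷_))
    part : Bool → Vec Bool n → ℤ
    part b v = toℤ (f (b ∷ v)) ℤ.* score σ v
    jump : Vec Bool n → ℤ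
    jump v = + ind (f (true ∷ v) xor f (false ∷ v))
    ordered : ∀ s v → f (not s ∷ v) ≤ᵇ f (s ∷ v) →
      (if s then f (false ∷ v) ≤ᵇ f (true ∷ v) else f (true ∷ v) ≤ᵇ f (false ∷ v))
    ordered true  v h = h
    ordered false v h = h
    eq₁ : ∀ a b z p q → a ℤ.* (p ℤ.+ z) ℤ.+ b ℤ.* (q ℤ.+ z) ≡ a ℤ.* z ℤ.+ b ℤ.* z ℤ.+ (p ℤ.* a ℤ.+ q ℤ.* b)
    eq₁ = ℤ-Solver.solve-∀

-- The second moment of a sum of n independent signs: the cross terms cancel.
∑-score² : ∀ {n} (σ : Vec Bool n) → ∑ℤ (λ v → score σ v ℤ.* score σ v) ≡ + n ℤ.* + (2 ^ n)
∑-score² [] = refl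
∑-score² {suc n} (s ∷ σ) = begin
  ∑ℤ (λ v → score (s ∷ σ) (true ∷ v) ℤ.* score (s ∷ σ) (true ∷ v)) ℤ.+ ∑ℤ (λ v → score (s ∷ σ) (false ∷ v) ℤ.* score (s ∷ σ) (false ∷ v))
    ≡⟨ sym (∑ℤ-+ (λ v → score (s ∷ σ) (true ∷ v) ℤ.* score (s ∷ σ) (true ∷ v)) (λ v → score (s ∷ σ) (false ∷ v) ℤ.* score (s ∷ σ) (false ∷ v))) ⟩
  ∑ℤ (λ v → score (s ∷ σ) (true ∷ v) ℤ.* score (s ∷ σ) (true ∷ v) ℤ.+ score (s ∷ σ) (false ∷ v) ℤ.* score (s ∷ σ) (false ∷ v))
    ≡⟨ ∑ℤ-cong (λ v → both s (score σ v)) ⟩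
  ∑ℤ (λ v → + 2 ℤ.* (score σ v ℤ.* score σ v ℤ.+ + 1))
    ≡⟨ trans (∑ℤ-* (+ 2) (λ v → score σ v ℤ.* score σ v ℤ.+ + 1)) (cong (+ 2 ℤ.*_) (∑ℤ-+ (λ v → score σ v ℤ.* score σ v) (λ _ → + 1))) ⟩
  + 2 ℤ.* (∑ℤ (λ v → score σ v ℤ.* score σ v) ℤ.+ ∑ℤ {n} (λ _ → + 1))
    ≡⟨ cong (+ 2 ℤ.*_) (cong₂ ℤ._+_ (∑-score² σ) (∑ℤ-1 n)) ⟩
  + 2 ℤ.* (+ n ℤ.* + (2 ^ n) ℤ.+ + (2 ^ n))
    ≡⟨ eq (+ n) (+ (2 ^ n)) ⟩
  (+ 1 ℤ.+ + n) ℤ.* (+ 2 ℤ.* + (2 ^ n))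
    ≡⟨ cong (+ suc n ℤ.*_) (sym (ℤₚ.pos-* 2 (2 ^ n))) ⟩
  + suc n ℤ.* + (2 ^ suc n) ∎
  where
    open ≡-Reasoning
    eq : ∀ a p → + 2 ℤ.* (a ℤ.* p ℤ.+ p) ≡ (+ 1 ℤ.+ a) ℤ.* (+ 2 ℤ.* p)
    eq = ℤ-Solver.solve-∀
    cross : ∀ z → (+ 1 ℤ.+ z) ℤ.* (+ 1 ℤ.+ z) ℤ.+ (- (+ 1) ℤ.+ z) ℤ.* (- (+ 1) ℤ.+ z) ≡ + 2 ℤ.* (z ℤ.* z ℤ.+ + 1)
    cross = ℤ-Solver.solve-∀
    both : ∀ s z → (toℤ s ℤ.* + 1 ℤ.+ z) ℤ.* (toℤ s ℤ.* + 1 ℤ.+ z) ℤ.+ (toℤ s ℤ.* - (+ 1) ℤ.+ z) ℤ.* (toℤ s ℤ.* - (+ 1) ℤ.+ z)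
      ≡ + 2 ℤ.* (z ℤ.* z ℤ.+ + 1)
    both true  z = cross z
    both false z = trans (ℤₚ.+-comm _ ((+ 1 ℤ.+ z) ℤ.* (+ 1 ℤ.+ z))) (cross z)

∑-≥-term : ∀ {n} (F : Vec Bool n → ℕ) v → F v ≤ ∑ bits F
∑-≥-term F []          = ≤-refl
∑-≥-term F (true ∷ v)  = ≤-trans (∑-≥-term (λ w → F (true ∷ w)) v) (m≤m+n _ _)
∑-≥-term F (false ∷ v) = ≤-trans (∑-≥-term (λ w → F (false ∷ w)) v) (m≤n+m _ _)

score-self : ∀ {n} (σ : Vec Bool n) → score σ σ ≡ + n
score-self []          = refl
score-self (true ∷ σ)  = cong (λ y → + 1 ℤ.+ y) (score-self σ)
score-self (false ∷ σ) = cong (λ y → + 1 ℤ.+ y) (score-self σ)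

square-∣∣ : ∀ z → z ℤ.* z ≡ + (∣ z ∣ * ∣ z ∣)
square-∣∣ (+ n)    = sym (ℤₚ.pos-* n n)
square-∣∣ -[1+ n ] = refl

-- Σᵥ (score σ v - 2 f v)² = n 2ⁿ - 4 N f + 4 · 2ⁿ, where N f = n 2ⁿ / 2; the left side is positive because of v = σ.
unate-unbalanced : ∀ {n} → 4 ≤ n → (σ : Vec Bool n) (f : Fun n) → Unate σ f → ¬ Balanced f
unate-unbalanced {n} 4≤n σ f u bal = <⇒≱ positive
  (+-cancelʳ-≤ (n * 2 ^ n) P 0 (≤-trans (≤-reflexive cancelled) (*-monoˡ-≤ (2 ^ n) 4≤n)))
  where
    open ≡-Reasoning
    -- With total influence n/2, the mean of (s - c f)² is n - cn + c², which is least at c = n/2.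
    -- The choice c = 2 is optimal for n = 4, where the mean would be 0; hence the need for one
    -- point with `z` nonzero.
    z : Vec Bool n → ℤ
    z v = score σ v ℤ.+ - (+ 2) ℤ.* toℤ (f v)
    P = ∑ bits (λ v → ∣ z v ∣ * ∣ z v ∣)
    apart : ∀ n → 4 ≤ n → ∀ b → 1 ≤ ∣ + n ℤ.+ - (+ 2) ℤ.* toℤ b ∣
    apart (suc (suc (suc (suc n)))) _ true  = s≤s z≤n
    apart (suc (suc (suc (suc n)))) _ false = s≤s z≤n
    apart (suc (suc (suc zero))) (s≤s (s≤s (s≤s ())))
    apart (suc (suc zero)) (s≤s (s≤s ()))
    apart (suc zero) (s≤s ())
    1≤∣zσ∣ : 1 ≤ ∣ z σ ∣
    1≤∣zσ∣ = subst (λ s → 1 ≤ ∣ s ℤ.+ - (+ 2) ℤ.* toℤ (f σ) ∣) (sym (score-self σ)) (apart n 4≤n (f σ))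
    positive : 0 < P
    positive = ≤-trans (*-mono-≤ 1≤∣zσ∣ 1≤∣zσ∣) (∑-≥-term (λ v → ∣ z v ∣ * ∣ z v ∣) σ)
    expand : ∀ s b → (s ℤ.+ - (+ 2) ℤ.* toℤ b) ℤ.* (s ℤ.+ - (+ 2) ℤ.* toℤ b) ≡
      s ℤ.* s ℤ.+ (- (+ 4) ℤ.* (toℤ b ℤ.* s) ℤ.+ + 4 ℤ.* + 1)
    expand s true = eq s
      where
        eq : ∀ s → (s ℤ.+ - (+ 2) ℤ.* + 1) ℤ.* (s ℤ.+ - (+ 2) ℤ.* + 1) ≡ s ℤ.* s ℤ.+ (- (+ 4) ℤ.* (+ 1 ℤ.* s) ℤ.+ + 4 ℤ.* + 1)
        eq = ℤ-Solver.solve-∀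
    expand s false = eq s
      where
        eq : ∀ s → (s ℤ.+ - (+ 2) ℤ.* - (+ 1)) ℤ.* (s ℤ.+ - (+ 2) ℤ.* - (+ 1)) ≡ s ℤ.* s ℤ.+ (- (+ 4) ℤ.* (- (+ 1) ℤ.* s) ℤ.+ + 4 ℤ.* + 1)
        eq = ℤ-Solver.solve-∀
    total : + P ≡ + n ℤ.* + (2 ^ n) ℤ.+ (- (+ 4) ℤ.* + N f ℤ.+ + 4 ℤ.* + (2 ^ n))
    total = begin
      + P
        ≡⟨ sym (∑ℤ-ℕ (λ v → ∣ z v ∣ * ∣ z v ∣)) ⟩
      ∑ℤ (λ v → + (∣ z v ∣ * ∣ z v ∣))
        ≡⟨ ∑ℤ-cong (λ v → trans (sym (square-∣∣ (z v))) (expand (score σ v) (f v))) ⟩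
      ∑ℤ (λ v → score σ v ℤ.* score σ v ℤ.+ (- (+ 4) ℤ.* (toℤ (f v) ℤ.* score σ v) ℤ.+ + 4 ℤ.* + 1))
        ≡⟨ ∑ℤ-+ (λ v → score σ v ℤ.* score σ v) (λ v → - (+ 4) ℤ.* (toℤ (f v) ℤ.* score σ v) ℤ.+ + 4 ℤ.* + 1) ⟩
      ∑ℤ (λ v → score σ v ℤ.* score σ v) ℤ.+ ∑ℤ (λ v → - (+ 4) ℤ.* (toℤ (f v) ℤ.* score σ v) ℤ.+ + 4 ℤ.* + 1)
        ≡⟨ cong₂ ℤ._+_ (∑-score² σ) (∑ℤ-+ (λ v → - (+ 4) ℤ.* (toℤ (f v) ℤ.* score σ v)) (λ _ → + 4 ℤ.* + 1)) ⟩
      + n ℤ.* + (2 ^ n) ℤ.+ (∑ℤ (λ v → - (+ 4) ℤ.* (toℤ (f v) ℤ.* score σ v)) ℤ.+ ∑ℤ {n} (λ _ → + 4 ℤ.* + 1))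
        ≡⟨ cong (λ y → + n ℤ.* + (2 ^ n) ℤ.+ y) (cong₂ ℤ._+_
             (trans (∑ℤ-* (- (+ 4)) (λ v → toℤ (f v) ℤ.* score σ v)) (cong (- (+ 4) ℤ.*_) (∑-score σ f u)))
             (trans (∑ℤ-* {n} (+ 4) (λ _ → + 1)) (cong (+ 4 ℤ.*_) (∑ℤ-1 n)))) ⟩
      + n ℤ.* + (2 ^ n) ℤ.+ (- (+ 4) ℤ.* + N f ℤ.+ + 4 ℤ.* + (2 ^ n)) ∎
    half : + 2 ℤ.* + N f ≡ + n ℤ.* + (2 ^ n)
    half = trans (sym (ℤₚ.pos-* 2 (N f))) (trans (cong +_ (N-balanced f bal)) (ℤₚ.pos-* n (2 ^ n)))
    cancelled : P + n * 2 ^ n ≡ 4 * 2 ^ n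
    cancelled = ℤₚ.+-injective (begin
      + (P + n * 2 ^ n)
        ≡⟨ trans (ℤₚ.pos-+ P (n * 2 ^ n)) (cong (λ y → + P ℤ.+ y) (ℤₚ.pos-* n (2 ^ n))) ⟩
      + P ℤ.+ + n ℤ.* + (2 ^ n)
        ≡⟨ cong (ℤ._+ + n ℤ.* + (2 ^ n)) total ⟩
      + n ℤ.* + (2 ^ n) ℤ.+ (- (+ 4) ℤ.* + N f ℤ.+ + 4 ℤ.* + (2 ^ n)) ℤ.+ + n ℤ.* + (2 ^ n)
        ≡⟨ cong (λ y → y ℤ.+ (- (+ 4) ℤ.* + N f ℤ.+ + 4 ℤ.* + (2 ^ n)) ℤ.+ y) (sym half) ⟩
      + 2 ℤ.* + N f ℤ.+ (- (+ 4) ℤ.* + N f ℤ.+ + 4 ℤ.* + (2 ^ n)) ℤ.+ + 2 ℤ.* + N f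
        ≡⟨ eq (+ N f) (+ (2 ^ n)) ⟩
      + 4 ℤ.* + (2 ^ n)
        ≡⟨ sym (ℤₚ.pos-* 4 (2 ^ n)) ⟩
      + (4 * 2 ^ n) ∎)
      where
        eq : ∀ a p → + 2 ℤ.* a ℤ.+ (- (+ 4) ℤ.* a ℤ.+ + 4 ℤ.* p) ℤ.+ + 2 ℤ.* a ≡ + 4 ℤ.* p
        eq = ℤ-Solver.solve-∀

-- Monotone functions and linear threshold functions

_⊑[_]_ : ∀ {n} → Input n → Vec Bool n → Input n → Set
x ⊑[ σ ] y = ∀ i → x i ≡ y i ⊎ (x i ≡ not (lookup σ i) × y i ≡ lookup σ i)

Increasing : ∀ {n} → Vec Bool n → BoolFun n → Set
Increasing σ f = ∀ {x y} → x ⊑[ σ ] y → f x ≤ᵇ f y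

-- Pointwise equal inputs are related in both directions, so antisymmetry of the order on `Bool`
-- applies.
increasing-ext : ∀ {n} (σ : Vec Bool n) f → Increasing σ f → Ext f
increasing-ext σ f inc h = ≤-antisym (inc (λ i → inj₁ (h i))) (inc (λ i → inj₁ (sym (h i))))

increasing⇒unate : ∀ {n} (σ : Vec Bool n) (f : Fun n) →
  (∀ {v w} → lookup v ⊑[ σ ] lookup w → f v ≤ᵇ f w) → Unate σ f
increasing⇒unate []      f inc = tt
increasing⇒unate (s ∷ σ) f inc =
  (λ v → inc (λ { zero → inj₂ (refl , refl) ; (suc i) → inj₁ refl })) ,
  (λ b → increasing⇒unate σ (f ∘ (b ∷_)) (λ h → inc (λ { zero → inj₁ refl ; (suc i) → h i })))

increasing⇒¬X : ∀ {n} → 4 ≤ n → (σ : Vec Bool n) (f : BoolFun n) → Increasing σ f → ¬ InX n f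
increasing⇒¬X 4≤n σ f inc fX = unate-unbalanced 4≤n σ (vec f)
  (increasing⇒unate σ (vec f) (λ h → inc h)) (X⇒balanced f (increasing-ext σ f inc) fX)

monotone⇒increasing : ∀ {n} (f : BoolFun n) → Monotone n f → Increasing (replicate n true) f
monotone⇒increasing {n} f mono {x} {y} h = mono x y (λ i → le i (lookup-replicate i true) (h i))
  where
    le : ∀ i → lookup (replicate n true) i ≡ true →
      x i ≡ y i ⊎ (x i ≡ not (lookup (replicate n true) i) × y i ≡ lookup (replicate n true) i) → x i ≤ᵇ y i
    le i σᵢ (inj₁ p) = subst (x i ≤ᵇ_) p b≤b
    le i σᵢ (inj₂ (p , q)) = subst₂ _≤ᵇ_ (sym (trans p (cong not σᵢ))) (sym (trans q σᵢ)) f≤t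

sumFin-mono : ∀ {n} {g h : Fin n → ℚ} → (∀ i → g i ℚ.≤ h i) → sumFin g ℚ.≤ sumFin h
sumFin-mono {n} {g} {h} le = go (List.allFin n)
  where
    go : ∀ is → List.foldr ℚ._+_ 0ℚ (List.map g is) ℚ.≤ List.foldr ℚ._+_ 0ℚ (List.map h is)
    go []       = ℚₚ.≤-refl
    go (i ∷ is) = ℚₚ.+-mono-≤ (le i) (go is)

-1≤1 : toℚ false ℚ.≤ toℚ true
-1≤1 = ℚ.*≤* ℤ.-≤+

-- Moving an input towards the sign of its weight never lowers the weighted sum, so σ records these
-- signs. For a zero weight either sign would do; here it is `true`.
LTF⇒increasing : ∀ {n} (f : BoolFun n) → LTF n f → Σ (Vec Bool n) λ σ → Increasing σ f
LTF⇒increasing {n} f (w₀ , w , spec) = σ , λ {x} {y} h → implies (f x) (f y) (λ fx →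
  proj₂ (spec y) (ℚₚ.<-≤-trans (proj₁ (spec x) fx) (ℚₚ.+-monoʳ-≤ w₀ (sumFin-mono (λ i → term {x} {y} i (h i))))))
  where
    positive? : Fin n → Bool
    positive? i = does (0ℚ ℚₚ.≤? w i)
    σ : Vec Bool n
    σ = tabulate positive?
    implies : ∀ a b → (a ≡ true → b ≡ true) → a ≤ᵇ b
    implies true  b     h = subst (true ≤ᵇ_) (sym (h refl)) b≤b
    implies false true  h = f≤t
    implies false false h = b≤b
    signed : ∀ q (d : Dec (0ℚ ℚ.≤ q)) → q ℚ.* toℚ (not (does d)) ℚ.≤ q ℚ.* toℚ (does d)
    signed q (yes 0≤q) = ℚₚ.*-monoˡ-≤-nonNeg q {{ℚ.nonNegative 0≤q}} -1≤1
    signed q (no  0≰q) = ℚₚ.*-monoˡ-≤-nonPos q {{ℚ.nonPositive (ℚₚ.<⇒≤ (ℚₚ.≰⇒> 0≰q))}} -1≤1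
    term : ∀ {x y : Input n} i → x i ≡ y i ⊎ (x i ≡ not (lookup σ i) × y i ≡ lookup σ i) →
      w i ℚ.* toℚ (x i) ℚ.≤ w i ℚ.* toℚ (y i)
    term i (inj₁ p) = ℚₚ.≤-reflexive (cong (λ b → w i ℚ.* toℚ b) p)
    term i (inj₂ (p , q)) rewrite p | q | lookup∘tabulate positive? i = signed (w i) (0ℚ ℚₚ.≤? w i)

-- Extensionality of circuits and the conclusion

literal-ext : ∀ {n} (l : Fin n × Bool) → Ext (λ x → literal x l)
literal-ext (i , true)  h = h i
literal-ext (i , false) h = cong not (h i)

evalL-ext : ∀ {n d w} (L : Levels n d w) t j → Ext (λ x → evalL L t x j)
evalL-ext (first w gs)   t j h = cong (gate t) (Listₚ.map-cong (λ l → literal-ext l h) (lookup gs j))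
evalL-ext (next L w′ gs) t j h = cong (gate t) (Listₚ.map-cong (λ i → evalL-ext L (not t) i h) (lookup gs j))

theorem1 : ((n : ℕ) → 4 ≤ n → (f : BoolFun n) → Monotone n f → ¬ InX n f)
    × ((n : ℕ) → 16 ≤ n → (f : BoolFun n) → LTF n f → ¬ InX n f)
    × ((c : ℕ) → (d : ℕ) → 1 ≤ d → Σ ℕ λ n₀ → 1 ≤ n₀ × ((n : ℕ) → n₀ ≤ n →
    (f : BoolFun n) → ComputedByCircuit n d (c * n ^ c) f → ¬ InX n f))
theorem1 =
  (λ n 4≤n f mono → increasing⇒¬X 4≤n (replicate n true) f (monotone⇒increasing f mono)) ,
  (λ n 16≤n f ltf → increasing⇒¬X (≤-trans (m≤m+n 4 12) 16≤n) (proj₁ (LTF⇒increasing f ltf)) f (proj₂ (LTF⇒increasing f ltf))) ,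
  (λ c d _ → proj₁ (N-circuit c d) , proj₁ (proj₂ (N-circuit c d)) ,
    λ n n₀≤n f (C , t , size≤ , f≗C) fX →
      let f-ext : Ext f
          f-ext {x} {y} h = trans (f≗C x) (trans (evalL-ext C t zero h) (sym (f≗C y)))
      in <⇒≢ (proj₂ (proj₂ (N-circuit c d)) n n₀≤n C t size≤)
           (trans (cong (2 *_) (N-cong (λ v → sym (f≗C (lookup v))))) (N-balanced (vec f) (X⇒balanced f f-ext fX))))
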